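{- Let $k,n\in\mathbb{N}$ with $3\leq k\leq n-1$. Let $\{D_I\}_{I\in\binom{[n]}{k}}$ be an l-treelike family of real numbers and let $U$ be the set of weighted trees with leaf set $[n]$ realizing the family. (i) If every element of $U$ is a pseudostar of kind $(n,k)$ (for instance if $k\leq n/2$), then $D_{tot}(\mathcal{P})=D_{tot}(\mathcal{P}')$ for all $\mathcal{P},\mathcal{P}'\in U$; in particular $\inf_{\mathcal{P}\in U} D_{tot}(\mathcal{P}) = \sup_{\mathcal{P}\in U} D_{tot}(\mathcal{P})$. (ii) If $U$ contains a weighted tree which is not a pseudostar of kind $(n,k)$, then $\inf_{\mathcal{T}\in U} D_{tot}(\mathcal{T})=-\infty$ and $\sup_{\mathcal{T}\in U} D_{tot}(\mathcal{T})=+\infty$.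
   Context: A weighted tree $\mathcal{T}=(T,w)$ is a finite tree with $w:E(T)\to\mathbb{R}$ (weights may be any real numbers). $D_I(\mathcal{T})$ is the total weight of the minimal subtree containing $I$; $D_{tot}(\mathcal{T})$ is the sum of the weights of all edges. A weighted tree with leaf set $[n]$ realizes $\{D_I\}_I$ if $D_I(\mathcal{T})=D_I$ for all $I\in\binom{[n]}{k}$. The family is l-treelike if there is a weighted tree and a subset $S$ of its leaves, identified with $[n]$, with $D_I(\mathcal{T})=D_I$ for all $k$-subsets $I\subseteq S$. A tree $P$ is a pseudostar of kind $(n,k)$ if $\#L(P)=n$ and every edge divides $L(P)$ into two sets at least one of which has cardinality $\geq k$. -}

module Defs where

open import Level using (0ℓ)
open import Data.Nat as ℕ using (ℕ; zero; suc)
open import Data.Fin as Fin using (Fin; zero; suc; toℕ; _≟_)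
open import Data.Fin.Subset using (Subset; inside)
open import Data.Vec using (lookup)
open import Data.Bool using (Bool; true; false; _∧_; _∨_; not; if_then_else_)
open import Data.List using (List; foldr; map)
open import Data.List.Base using (allFin)
open import Data.Product using (Σ; ∃; _×_; _,_)
open import Relation.Nullary using (¬_; does)
open import Relation.Binary.PropositionalEquality using (_≡_)
open import Relation.Binary.Structures using (IsTotalOrder)
open import Algebra.Bundles using (CommutativeRing)
open import Function.Definitions using (Injective)

-- The real numbers, axiomatised as a complete ordered field.
-- (Any model is isomorphic to ℝ, so quantifying over all models
-- is the same as speaking about ℝ.)

record RealField : Set₁ where
  field
    ring : CommutativeRing 0ℓ 0ℓ
  open CommutativeRing ring public hiding (ring)
  field
    _≤_          : Carrier → Carrier → Set
    isTotalOrder : IsTotalOrder _≈_ _≤_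
    +-mono-≤     : ∀ {x y} z → x ≤ y → (x + z) ≤ (y + z)
    *-nonneg     : ∀ {x y} → 0# ≤ x → 0# ≤ y → 0# ≤ (x * y)
    0≉1          : ¬ (0# ≈ 1#)
    inverse      : ∀ x → ¬ (x ≈ 0#) → Σ Carrier (λ y → (x * y) ≈ 1#)
    lub          : (P : Carrier → Set) → Σ Carrier P →
                   Σ Carrier (λ b → ∀ x → P x → x ≤ b) →
                   Σ Carrier (λ s → (∀ x → P x → x ≤ s) ×
                                    (∀ b → (∀ x → P x → x ≤ b) → s ≤ b))

  _<_ : Carrier → Carrier → Set
  x < y = (x ≤ y) × ¬ (x ≈ y)

-- Finite trees.
-- A finite tree is encoded (up to isomorphism) on the vertex set
-- Fin (suc m): vertex 0 is a root and vertex (suc i) has parent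
-- 'parent i' with index ≤ i.  Every finite tree admits such a
-- labelling (e.g. BFS order), and all notions below are invariant
-- under isomorphism.  The edges are indexed by Fin m: edge i joins
-- vertex (suc i) and 'parent i'.

record Tree : Set where
  field
    m        : ℕ
    parent   : Fin m → Fin (suc m)
    parent≤  : ∀ i → toℕ (parent i) ℕ.≤ toℕ i

  Vertex : Set
  Vertex = Fin (suc m)

  Edge : Set
  Edge = Fin m

  up : Vertex → Vertex
  up zero    = zero
  up (suc i) = parent i

  belowFuel : ℕ → Vertex → Vertex → Bool
  belowFuel zero    u v = does (v ≟ u)
  belowFuel (suc f) u v = does (v ≟ u) ∨ belowFuel f u (up v)

  below : Vertex → Vertex → Bool
  below u v = belowFuel (suc m) u v

  lowerSide : Edge → Vertex → Bool
  lowerSide e v = below (suc e) v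

  countB : ∀ {A : Set} → List A → (A → Bool) → ℕ
  countB xs p = foldr (λ x r → if p x then suc r else r) zero xs

  degree : Vertex → ℕ
  degree v = countB (allFin m) (λ i → does (parent i ≟ v))
             ℕ.+ (if does (v ≟ zero) then 0 else 1)

  IsLeaf : Vertex → Set
  IsLeaf v = degree v ≡ 1

record WTree (R : RealField) : Set where
  field
    tree   : Tree
    weight : Tree.Edge tree → RealField.Carrier R
  open Tree tree public

module WithReals (R : RealField) where
  open RealField R

  sumR : ∀ {A : Set} → List A → (A → Carrier) → Carrier
  sumR xs f = foldr (λ x r → f x + r) 0# xs

  record LTree (n : ℕ) : Set where
    field
      wt      : WTree R
    open WTree wt public
    field
      lab     : Fin n → Vertex
      lab-inj : Injective _≡_ _≡_ lab
      lab-leaf : ∀ j → IsLeaf (lab j)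

  module _ {n : ℕ} (T : LTree n) where
    open LTree T

    -- edge e lies in the minimal subtree containing the labelled leaves in I
    -- iff I meets both sides of e
    inMinSubtree : Subset n → Edge → Bool
    inMinSubtree I e =
      foldr _∨_ false (map (λ j → lookup I j ∧ lowerSide e (lab j)) (allFin n)) ∧
      foldr _∨_ false (map (λ j → lookup I j ∧ not (lowerSide e (lab j))) (allFin n))

    D : Subset n → Carrier
    D I = sumR (allFin m) (λ e → if inMinSubtree I e then weight e else 0#)

    Dtot : Carrier
    Dtot = sumR (allFin m) weight

    LeafSetIsN : Set
    LeafSetIsN = ∀ v → IsLeaf v → Σ (Fin n) (λ j → lab j ≡ v)

    leavesBelow : Edge → ℕ
    leavesBelow e = countB (allFin n) (λ j → lowerSide e (lab j))

    leavesAbove : Edge → ℕ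
    leavesAbove e = countB (allFin n) (λ j → not (lowerSide e (lab j)))

    IsPseudostar : ℕ → Set
    IsPseudostar k = ∀ e → (k ℕ.≤ leavesBelow e) Data.Sum.⊎ (k ℕ.≤ leavesAbove e)
      where import Data.Sum

  Realises : ∀ {n} → LTree n → (k : ℕ) → (Subset n → Carrier) → Set
  Realises {n} T k Dfam = ∀ (I : Subset n) → Data.Fin.Subset.∣ I ∣ ≡ k → D T I ≈ Dfam I
    where import Data.Fin.Subset

  LTreelike : (n k : ℕ) → (Subset n → Carrier) → Set
  LTreelike n k Dfam = Σ (LTree n) (λ T → Realises T k Dfam)

  InU : (n k : ℕ) → (Subset n → Carrier) → LTree n → Set
  InU n k Dfam T = LeafSetIsN T × Realises T k Dfam

{-# OPTIONS --safe #-}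
-- Uniqueness. Subtract the weights of two pseudostars P, P′ realising the family: for a test function f
-- on splits of [n], W f is the sum of f over the edges of P minus the sum over the edges of P′. The
-- hypothesis is W (crosses K) = 0 for |K| = k. Write H(A | B) = W (separates A B). For |J| = k - 2
-- the four-point identity gives the same value H(ijJ | lm) + H(ij | lmJ) for the three pairings
-- of i, j, l, m; each tree displays at most one of them, so one value is zero and hence all are.
-- A 5-cycle argument then yields H(ij | K) = 0 for |K| = k, and H(A | B) = H(xA | B) + H(A | xB)
-- propagates this to |A| ≥ 2, |B| ≥ k. In a pseudostar, every split with both sides of size ≥ 2 is of
-- this form, so H(A | B) = 0 whenever |A|, |B| ≥ 2. Only the splits cutting off one label remain;
-- they contribute equally, hence not at all.
--
-- Unboundedness. Every k-subset crosses an edge that violates the pseudostar condition, so weight can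
-- be moved between this edge and the n pendant edges without changing any D_I; as k < n, the
-- total weight changes.
module Submission where

open import Defs
open import Algebra.Bundles using (CommutativeRing)
import Algebra.Properties.AbelianGroup as AbelianGroupProperties
import Algebra.Properties.CommutativeMonoid.Mult as Mult
import Algebra.Properties.Semiring.Mult as SemiringMult
import Algebra.Properties.Ring as RingProperties
import Algebra.Properties.CommutativeSemigroup as CommutativeSemigroupProperties
open import Data.Bool using (Bool; true; false; _∧_; _∨_; not; if_then_else_)
open import Data.Bool.ListAction using (all; any)
import Data.Bool.Properties as Bool
open import Data.Empty using (⊥; ⊥-elim)
open import Data.Fin using (Fin; zero; suc; toℕ)
import Data.Fin.Properties as Fin
open import Data.Fin.Subset using (Subset; ∣_∣; inside; outside) renaming (⊥ to ∅)
import Data.Fin.Subset.Properties as Subset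
open import Data.List using (List; []; _∷_; _++_; length; allFin; foldr)
open import Data.List.Properties using (length-++; length-tabulate)
import Data.List as List
import Data.List.Membership.DecPropositional as DecMembership
open import Data.List.Membership.Propositional using (_∈_)
open import Data.List.Membership.Propositional.Properties using (∈-allFin; ∈-++⁻)
open import Data.List.Relation.Binary.Permutation.Propositional
  using (_↭_; prep; swap; ↭-refl; ↭-sym; ↭-trans; ↭⇒↭ₛ)
open import Data.List.Relation.Binary.Permutation.Propositional.Properties
  using (shift; ++⁺ˡ; ++⁺ʳ; ++-comm; ↭-length)
import Data.List.Relation.Binary.Permutation.Setoid.Properties as Permutationₛ
open import Data.List.Relation.Unary.All using ([]; _∷_)
import Data.List.Relation.Unary.All as All
import Data.List.Relation.Unary.All.Properties as All
open import Data.List.Relation.Unary.AllPairs using ([]; _∷_)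
open import Data.List.Relation.Unary.Any using (here; there)
open import Data.List.Relation.Unary.Unique.Propositional using (Unique)
import Data.List.Relation.Unary.Unique.Propositional.Properties as Unique
open import Data.Nat as ℕ using (ℕ; zero; suc; _≤_; z≤n; s≤s)
import Data.Nat.Properties as ℕ
open import Data.Product using (Σ; ∃; _×_; _,_; proj₁; proj₂)
open import Data.Sum using (_⊎_; inj₁; inj₂; [_,_]′)
import Data.Sum as Sum
open import Data.Vec using (lookup; tabulate; _[_]≔_)
import Data.Vec as Vec
import Data.Vec.Properties as Vec
open import Function using (_∘_; id)
open import Relation.Binary.PropositionalEquality as ≡
  using (_≡_; _≢_; refl; sym; trans; cong; cong₂; subst; subst₂)
open import Relation.Binary.Structures using (IsTotalOrder)
open import Relation.Nullary using (¬_; Dec; yes; no; does; contradiction)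
open import Relation.Nullary.Decidable using (from-yes; _×-dec_; _⊎-dec_; _→-dec_; ¬?; map′)

-- Splits of the label set and Boolean identities between functions on splits.

private variable n : ℕ

-- Makes identities in finitely many Boolean variables decidable, so that `from-yes` proves them by
-- evaluating the truth table.
∀-Bool? : {P : Bool → Set} → (∀ b → Dec (P b)) → Dec (∀ b → P b)
∀-Bool? P? = map′ (λ { (t , f) true → t ; (t , f) false → f }) (λ h → h true , h false)
               (P? true ×-dec P? false)

⟦_⟧ : Bool → ℕ
⟦ b ⟧ = if b then 1 else 0

-- A split of the labels is given by (the indicator of) one of its two sides.
Split : ℕ → Set
Split n = Fin n → Bool

none : Split n → List (Fin n) → Bool
none σ = all (not ∘ σ)

-- The two summands are the two orientations, as a split may be given by either side. They exclude
-- each other as soon as one of the lists is nonempty.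
separates : List (Fin n) → List (Fin n) → Split n → ℕ
separates A B σ = ⟦ all σ A ∧ none σ B ⟧ ℕ.+ ⟦ none σ A ∧ all σ B ⟧

crosses : List (Fin n) → Split n → ℕ
crosses K σ = ⟦ not (all σ K) ∧ not (none σ K) ⟧

all-↭ : (p : Fin n → Bool) {A B : List (Fin n)} → A ↭ B → all p A ≡ all p B
all-↭ p _↭_.refl = refl
all-↭ p (prep x r) = cong (p x ∧_) (all-↭ p r)
all-↭ p (swap x y r) = trans (cong (λ a → p x ∧ (p y ∧ a)) (all-↭ p r))
  (from-yes (∀-Bool? λ a → ∀-Bool? λ b → ∀-Bool? λ c → (a ∧ (b ∧ c)) Bool.≟ (b ∧ (a ∧ c)))
    (p x) (p y) _)
all-↭ p (_↭_.trans r s) = trans (all-↭ p r) (all-↭ p s)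

crosses-↭ : {A B : List (Fin n)} → A ↭ B → ∀ σ → crosses A σ ≡ crosses B σ
crosses-↭ r σ = cong₂ (λ a b → ⟦ not a ∧ not b ⟧) (all-↭ σ r) (all-↭ (not ∘ σ) r)

separates-↭ʳ : ∀ A {B C : List (Fin n)} → B ↭ C → ∀ σ → separates A B σ ≡ separates A C σ
separates-↭ʳ A r σ = cong₂ (λ a b → ⟦ all σ A ∧ b ⟧ ℕ.+ ⟦ none σ A ∧ a ⟧)
                       (all-↭ σ r) (all-↭ (not ∘ σ) r)

separates-sym : (A B : List (Fin n)) → ∀ σ → separates A B σ ≡ separates B A σ
separates-sym A B σ =
  trans (ℕ.+-comm ⟦ all σ A ∧ none σ B ⟧ _)
    (cong₂ ℕ._+_ (cong ⟦_⟧ (Bool.∧-comm (none σ A) _)) (cong ⟦_⟧ (Bool.∧-comm (all σ A) _)))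

-- In either orientation, x lies on the side of A or on the side of B, and not on both.
separates-insert : ∀ x (A B : List (Fin n)) σ →
  separates A B σ ≡ separates (x ∷ A) B σ ℕ.+ separates A (x ∷ B) σ
separates-insert x A B σ =
  from-yes (∀-Bool? λ x → ∀-Bool? λ a → ∀-Bool? λ a′ → ∀-Bool? λ b → ∀-Bool? λ b′ →
    (⟦ a ∧ b′ ⟧ ℕ.+ ⟦ a′ ∧ b ⟧) ℕ.≟
    ((⟦ (x ∧ a) ∧ b′ ⟧ ℕ.+ ⟦ (not x ∧ a′) ∧ b ⟧) ℕ.+ (⟦ a ∧ (not x ∧ b′) ⟧ ℕ.+ ⟦ a′ ∧ (x ∧ b) ⟧)))
  (σ x) (all σ A) (none σ A) (all σ B) (none σ B)

-- If `c ∷ C` does not cross the split, it lies on one side, and x must lie on the other. The label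
-- c keeps the list nonempty: over the empty list, `separates` would count 1 and `crosses` 0.
crosses-insert : ∀ x c (C : List (Fin n)) σ →
  crosses (x ∷ c ∷ C) σ ≡ crosses (c ∷ C) σ ℕ.+ separates (x ∷ []) (c ∷ C) σ
crosses-insert x c C σ =
  from-yes (∀-Bool? λ x → ∀-Bool? λ c → ∀-Bool? λ a → ∀-Bool? λ a′ →
    ⟦ not (x ∧ (c ∧ a)) ∧ not (not x ∧ (not c ∧ a′)) ⟧ ℕ.≟
    (⟦ not (c ∧ a) ∧ not (not c ∧ a′) ⟧ ℕ.+
      (⟦ (x ∧ true) ∧ (not c ∧ a′) ⟧ ℕ.+ ⟦ (not x ∧ true) ∧ (c ∧ a) ⟧)))
  (σ x) (σ c) (all σ C) (none σ C)

crosses-pair : ∀ (a b : Fin n) σ → crosses (a ∷ b ∷ []) σ ≡ separates (a ∷ []) (b ∷ []) σ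
crosses-pair a b σ =
  from-yes (∀-Bool? λ a → ∀-Bool? λ b →
    ⟦ not (a ∧ (b ∧ true)) ∧ not (not a ∧ (not b ∧ true)) ⟧ ℕ.≟
    (⟦ (a ∧ true) ∧ (not b ∧ true) ⟧ ℕ.+ ⟦ (not a ∧ true) ∧ (b ∧ true) ⟧))
  (σ a) (σ b)

-- For a nonempty J: the splits separating i, j from l, m that leave J on one side.
quartet : (i j l m : Fin n) → List (Fin n) → Split n → ℕ
quartet i j l m J σ = separates (i ∷ j ∷ J) (l ∷ m ∷ []) σ ℕ.+ separates (i ∷ j ∷ []) (l ∷ m ∷ J) σ

-- The four-point identity, with both sides moved so that no subtraction occurs.
crosses-quartet : ∀ (i j l m x : Fin n) J σ →
  (crosses (i ∷ j ∷ x ∷ J) σ ℕ.+ crosses (l ∷ m ∷ x ∷ J) σ) ℕ.+ quartet i j l m (x ∷ J) σ ≡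
  (crosses (i ∷ l ∷ x ∷ J) σ ℕ.+ crosses (j ∷ m ∷ x ∷ J) σ) ℕ.+ quartet i l j m (x ∷ J) σ
crosses-quartet i j l m x J σ =
  from-yes (∀-Bool? λ i → ∀-Bool? λ j → ∀-Bool? λ l → ∀-Bool? λ m → ∀-Bool? λ x →
            ∀-Bool? λ a → ∀-Bool? λ b → identity i j l m (x ∧ a) (not x ∧ b))
  (σ i) (σ j) (σ l) (σ m) (σ x) (all σ J) (none σ J)
  where
  cr : (i j a b : Bool) → ℕ
  cr i j a b = ⟦ not (i ∧ (j ∧ a)) ∧ not (not i ∧ (not j ∧ b)) ⟧
  q : (i j l m a b : Bool) → ℕ
  q i j l m a b = (⟦ (i ∧ (j ∧ a)) ∧ (not l ∧ (not m ∧ true)) ⟧ ℕ.+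
                   ⟦ (not i ∧ (not j ∧ b)) ∧ (l ∧ (m ∧ true)) ⟧) ℕ.+
                  (⟦ (i ∧ (j ∧ true)) ∧ (not l ∧ (not m ∧ b)) ⟧ ℕ.+
                   ⟦ (not i ∧ (not j ∧ true)) ∧ (l ∧ (m ∧ a)) ⟧)
  identity : ∀ i j l m a b → Dec ((cr i j a b ℕ.+ cr l m a b) ℕ.+ q i j l m a b ≡
                                  (cr i l a b ℕ.+ cr j m a b) ℕ.+ q i l j m a b)
  identity i j l m a b = _ ℕ.≟ _

-- Quartets pq|rt displayed by a split, and laminarity.

record Quartet (σ : Split n) (p q r t : Fin n) : Set where
  constructor mkQuartet
  field
    p≡q : σ p ≡ σ q
    r≡t : σ r ≡ σ t
    p≢r : σ p ≢ σ r

separates⇒Quartet : ∀ (p q r t : Fin n) A B σ →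
  separates (p ∷ q ∷ A) (r ∷ t ∷ B) σ ≢ 0 → Quartet σ p q r t
separates⇒Quartet p q r t A B σ ≢0 =
  let p≡q , r≡t , p≢r =
        from-yes (∀-Bool? λ p → ∀-Bool? λ q → ∀-Bool? λ r → ∀-Bool? λ t →
                  ∀-Bool? λ a → ∀-Bool? λ a′ → ∀-Bool? λ b → ∀-Bool? λ b′ →
          ¬? ((⟦ (p ∧ (q ∧ a)) ∧ (not r ∧ (not t ∧ b′)) ⟧ ℕ.+
               ⟦ (not p ∧ (not q ∧ a′)) ∧ (r ∧ (t ∧ b)) ⟧) ℕ.≟ 0)
          →-dec ((p Bool.≟ q) ×-dec ((r Bool.≟ t) ×-dec ¬? (p Bool.≟ r))))
        (σ p) (σ q) (σ r) (σ t) (all σ A) (none σ A) (all σ B) (none σ B) ≢0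
  in mkQuartet p≡q r≡t p≢r

quartet⇒Quartet : ∀ (i j l m : Fin n) J σ → quartet i j l m J σ ≢ 0 → Quartet σ i j l m
quartet⇒Quartet i j l m J σ ≢0 with separates (i ∷ j ∷ J) (l ∷ m ∷ []) σ in eq
... | zero  = separates⇒Quartet i j l m [] J σ ≢0
... | suc _ = separates⇒Quartet i j l m J [] σ λ eq′ → contradiction (trans (sym eq) eq′) λ ()

-- σ and τ are the sides, away from a common base point, of two edges of a tree.
Laminar : Split n → Split n → Set
Laminar {n} σ τ = ∀ (a b c : Fin n) → σ a ≡ true → τ a ≡ true →
  σ b ≡ true → τ b ≡ false → σ c ≡ false → τ c ≡ true → ⊥

-- Displaying two different pairings would put the four labels into all four combinations of sides
-- of σ and τ, three of which laminarity forbids to occur together.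
Laminar⇒¬Quartets : ∀ {σ τ : Split n} → Laminar σ τ → ∀ {p q r t} →
  Quartet σ p q r t → Quartet τ p r q t → ⊥
Laminar⇒¬Quartets {σ = σ} {τ} lam {p} {q} {r} {t} (mkQuartet σpq σrt σpr) (mkQuartet τpr τqt τpq)
  with σ p in σp | σ r in σr | τ p in τp | τ q in τq
... | true  | true  | _     | _     = σpr refl
... | false | false | _     | _     = σpr refl
... | _     | _     | true  | true  = τpq refl
... | _     | _     | false | false = τpq refl
... | true  | false | true  | false = lam p q r σp τp (sym σpq) τq σr (sym τpr)
... | true  | false | false | true  = lam q p t (sym σpq) τq σp τp (sym σrt) (sym τqt)
... | false | true  | true  | false = lam r t p σr (sym τpr) (sym σrt) (sym τqt) σp τp
... | false | true  | false | true  = lam t r q (sym σrt) (sym τqt) σr (sym τpr) (sym σpq) τq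

Quartet-sym : ∀ {σ : Split n} {p q r t} → Quartet σ p q r t → Quartet σ p q t r
Quartet-sym (mkQuartet a b c) = mkQuartet a (sym b) (λ e → c (trans e (sym b)))

-- Repetition-free lists as subsets, and cardinalities.

Unique-resp-↭ : {A B : List (Fin n)} → A ↭ B → Unique A → Unique B
Unique-resp-↭ r = Permutationₛ.Unique-resp-↭ (≡.setoid _) (↭⇒↭ₛ r)

Unique-tail : ∀ {x} {A : List (Fin n)} → Unique (x ∷ A) → Unique A
Unique-tail (_ ∷ u) = u

fromList : List (Fin n) → Subset n
fromList = foldr (λ x s → s [ x ]≔ inside) ∅

∣insert∣≤ : ∀ x (s : Subset n) → ∣ s [ x ]≔ inside ∣ ≤ suc ∣ s ∣
∣insert∣≤ zero (inside  Vec.∷ s) = ℕ.n≤1+n _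
∣insert∣≤ zero (outside Vec.∷ s) = ℕ.≤-refl
∣insert∣≤ (suc x) (inside  Vec.∷ s) = s≤s (∣insert∣≤ x s)
∣insert∣≤ (suc x) (outside Vec.∷ s) = ∣insert∣≤ x s

∣insert∣ : ∀ x (s : Subset n) → lookup s x ≡ outside → ∣ s [ x ]≔ inside ∣ ≡ suc ∣ s ∣
∣insert∣ zero (outside Vec.∷ s) _ = refl
∣insert∣ (suc x) (inside  Vec.∷ s) e = cong suc (∣insert∣ x s e)
∣insert∣ (suc x) (outside Vec.∷ s) e = ∣insert∣ x s e

lookup-fromList⁺ : ∀ {x} {A : List (Fin n)} → x ∈ A → lookup (fromList A) x ≡ true
lookup-fromList⁺ {x = x} {y ∷ A} x∈ with x Fin.≟ y
... | yes refl = Vec.lookup∘updateAt x (fromList A)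
... | no x≢y with x∈
...   | here e = contradiction e x≢y
...   | there x∈A = trans (Vec.lookup∘updateAt′ x y x≢y (fromList A)) (lookup-fromList⁺ x∈A)

lookup-fromList⁻ : ∀ {x} (A : List (Fin n)) → lookup (fromList A) x ≡ true → x ∈ A
lookup-fromList⁻ {x = x} [] e = contradiction (trans (sym e) (Vec.lookup-replicate x outside)) λ ()
lookup-fromList⁻ {x = x} (y ∷ A) e with x Fin.≟ y
... | yes refl = here refl
... | no x≢y = there (lookup-fromList⁻ A (trans (sym (Vec.lookup∘updateAt′ x y x≢y (fromList A))) e))

∣fromList∣≤ : (A : List (Fin n)) → ∣ fromList A ∣ ≤ length A
∣fromList∣≤ {n} [] = ℕ.≤-reflexive (Subset.∣⊥∣≡0 n)
∣fromList∣≤ (x ∷ A) = ℕ.≤-trans (∣insert∣≤ x (fromList A)) (s≤s (∣fromList∣≤ A))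

∣fromList∣ : {A : List (Fin n)} → Unique A → ∣ fromList A ∣ ≡ length A
∣fromList∣ {n} {[]} _ = Subset.∣⊥∣≡0 n
∣fromList∣ {A = x ∷ A} (x∉ ∷ u) = trans (∣insert∣ x (fromList A) (Bool.¬-not x∉A)) (cong suc (∣fromList∣ u))
  where x∉A = λ e → All.lookup x∉ (lookup-fromList⁻ A e) refl

card : (Fin n → Bool) → ℕ
card p = ∣ tabulate p ∣

lookup-mono⇒∣∣≤ : (I J : Subset n) → (∀ j → lookup I j ≡ true → lookup J j ≡ true) → ∣ I ∣ ≤ ∣ J ∣
lookup-mono⇒∣∣≤ I J h = Subset.p⊆q⇒∣p∣≤∣q∣ {p = I} λ {j} j∈I →
  Vec.lookup⇒[]= j J (h j (Vec.[]=⇒lookup j∈I))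

card≤length : ∀ (p : Fin n → Bool) A → (∀ j → p j ≡ true → j ∈ A) → card p ≤ length A
card≤length p A h =
  ℕ.≤-trans (lookup-mono⇒∣∣≤ (tabulate p) (fromList A) λ j e →
              lookup-fromList⁺ (h j (trans (sym (Vec.lookup∘tabulate p j)) e)))
            (∣fromList∣≤ A)

all⁻ : ∀ {A : List (Fin n)} (p : Fin n → Bool) → all p A ≡ true → ∀ {x} → x ∈ A → p x ≡ true
all⁻ {A = y ∷ A} p e x∈ with p y in py
all⁻ {A = y ∷ A} p () x∈ | false
all⁻ {A = y ∷ A} p e (here refl) | true = py
all⁻ {A = y ∷ A} p e (there x∈)  | true = all⁻ p e x∈

clash : ∀ {b} {X : Set} → b ≡ true → b ≡ false → X
clash refl ()

∧-true : ∀ {a b} → a ∧ b ≡ true → a ≡ true × b ≡ true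
∧-true {true} {true} _ = refl , refl

⟦⟧≢0 : ∀ {b} → ⟦ b ⟧ ≢ 0 → b ≡ true
⟦⟧≢0 {true}  _  = refl
⟦⟧≢0 {false} ≢0 = contradiction refl ≢0

-- As A and B cover all labels, a split separating them has its two sides contained in A and B.
-- Hence neither side reaches k elements when both lists are shorter than k.
separates-card : ∀ (A B : List (Fin n)) σ → (∀ j → j ∈ A ⊎ j ∈ B) → separates A B σ ≢ 0 →
  (card σ ≤ length A ⊎ card σ ≤ length B) × (card (not ∘ σ) ≤ length A ⊎ card (not ∘ σ) ≤ length B)
separates-card {n} A B σ covers ≢0 with all σ A ∧ none σ B in eq
... | true  = let A⊆ , B⊆ = ∧-true eq in
  inj₁ (card≤length σ A λ j e → [ id , (λ j∈B → clash e (Bool.not-injective (all⁻ (not ∘ σ) B⊆ j∈B))) ]′ (covers j)) ,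
  inj₂ (card≤length (not ∘ σ) B λ j e → [ (λ j∈A → clash (all⁻ σ A⊆ j∈A) (Bool.not-injective e)) , id ]′ (covers j))
... | false = let A⊆ , B⊆ = ∧-true (⟦⟧≢0 ≢0) in
  inj₂ (card≤length σ B λ j e → [ (λ j∈A → clash e (Bool.not-injective (all⁻ (not ∘ σ) A⊆ j∈A))) , id ]′ (covers j)) ,
  inj₁ (card≤length (not ∘ σ) A λ j e → [ id , (λ j∈B → clash (all⁻ σ B⊆ j∈B) (Bool.not-injective e)) ]′ (covers j))

-- Ordered fields: characteristic zero and division by positive integers.

module OrderedField (R : RealField) where
  open RealField R hiding (_≤_; ring; zero) renaming (refl to ≈-refl; sym to ≈-sym; trans to ≈-trans)
  open RealField R using () renaming (_≤_ to infix 4 _≤ᴿ_)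
  open CommutativeRing (RealField.ring R) using (ring)
  open WithReals R using (sumR)
  open Mult +-commutativeMonoid public using () renaming (_×_ to _·_)
  open Mult +-commutativeMonoid hiding (_×_)
  open SemiringMult semiring using (×-assoc-*)
  open CommutativeSemigroupProperties +-commutativeSemigroup using (interchange)
  open AbelianGroupProperties +-abelianGroup
    using (⁻¹-∙-comm; ⁻¹-involutive; ∙-cancelˡ; ∙-cancelʳ)
  open RingProperties ring using (-‿distribˡ-*)
  open IsTotalOrder isTotalOrder using (total; ≤-resp-≈)
    renaming (trans to ≤-trans; antisym to ≤-antisym)
  open import Relation.Binary.Reasoning.Setoid setoid

  -- If 1 ≤ 0, then 0 ≤ -1, and the square of -1 is 1.
  0≤1 : 0# ≤ᴿ 1#
  0≤1 with total 0# 1#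
  ... | inj₁ 0≤1 = 0≤1
  ... | inj₂ 1≤0 = proj₁ ≤-resp-≈ -1*-1≈1 (*-nonneg 0≤-1 0≤-1)
    where
    0≤-1 : 0# ≤ᴿ - 1#
    0≤-1 = proj₁ ≤-resp-≈ (+-identityˡ (- 1#)) (proj₂ ≤-resp-≈ (-‿inverseʳ 1#) (+-mono-≤ (- 1#) 1≤0))
    -1*-1≈1 : - 1# * - 1# ≈ 1#
    -1*-1≈1 = begin
      - 1# * - 1#   ≈⟨ -‿distribˡ-* 1# (- 1#) ⟨
      - (1# * - 1#) ≈⟨ -‿cong (*-identityˡ (- 1#)) ⟩
      - (- 1#)      ≈⟨ ⁻¹-involutive 1# ⟩
      1#            ∎

  x≤x+1 : ∀ x → x ≤ᴿ x + 1#
  x≤x+1 x = proj₁ ≤-resp-≈ (+-comm 1# x) (proj₂ ≤-resp-≈ (+-identityˡ x) (+-mono-≤ x 0≤1))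

  0≤n·1 : ∀ j → 0# ≤ᴿ j · 1#
  0≤n·1 zero = IsTotalOrder.refl isTotalOrder
  0≤n·1 (suc j) = ≤-trans (0≤n·1 j) (proj₁ ≤-resp-≈ (+-comm _ 1#) (x≤x+1 (j · 1#)))

  -- Adding 1 to the nonnegative `j · 1#` gives at least 1, so a zero value would force 1 ≤ 0.
  suc·1≉0 : ∀ j → ¬ (suc j · 1# ≈ 0#)
  suc·1≉0 j e = 0≉1 (≤-antisym 0≤1 (proj₁ ≤-resp-≈ e
    (proj₂ ≤-resp-≈ (+-identityˡ 1#) (proj₁ ≤-resp-≈ (+-comm _ 1#) (+-mono-≤ 1# (0≤n·1 j))))))

  ·-divide : ∀ j x → Σ Carrier λ y → suc j · y ≈ x
  ·-divide j x with inverse (suc j · 1#) (suc·1≉0 j)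
  ... | z , [1+j]z≈1 = z * x , (begin
    suc j · (z * x)        ≈⟨ ×-congʳ (suc j) (*-identityˡ (z * x)) ⟨
    suc j · (1# * (z * x)) ≈⟨ ×-assoc-* (suc j) 1# (z * x) ⟨
    suc j · 1# * (z * x)   ≈⟨ *-assoc _ z x ⟨
    suc j · 1# * z * x     ≈⟨ *-congʳ [1+j]z≈1 ⟩
    1# * x                 ≈⟨ *-identityˡ x ⟩
    x                      ∎)

  ·-torsionfree : ∀ j {x} → suc j · x ≈ 0# → x ≈ 0#
  ·-torsionfree j {x} e with inverse (suc j · 1#) (suc·1≉0 j)
  ... | z , [1+j]z≈1 = begin
    x                      ≈⟨ *-identityˡ x ⟨
    1# * x                 ≈⟨ *-congʳ [1+j]z≈1 ⟨
    suc j · 1# * z * x     ≈⟨ *-congʳ (*-comm _ z) ⟩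
    z * (suc j · 1#) * x   ≈⟨ *-assoc z _ x ⟩
    z * (suc j · 1# * x)   ≈⟨ *-congˡ (×-assoc-* (suc j) 1# x) ⟩
    z * (suc j · (1# * x)) ≈⟨ *-congˡ (×-congʳ (suc j) (*-identityˡ x)) ⟩
    z * (suc j · x)        ≈⟨ *-congˡ e ⟩
    z * 0#                 ≈⟨ zeroʳ z ⟩
    0#                     ∎

  -- Finite sums and weighted systems of splits.

  sumR-cong : ∀ {A : Set} (xs : List A) {f g : A → Carrier} → (∀ x → f x ≈ g x) → sumR xs f ≈ sumR xs g
  sumR-cong [] f≈g = ≈-refl
  sumR-cong (x ∷ xs) f≈g = +-cong (f≈g x) (sumR-cong xs f≈g)

  sumR-+ : ∀ {A : Set} (xs : List A) (f g : A → Carrier) →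
    sumR xs (λ x → f x + g x) ≈ sumR xs f + sumR xs g
  sumR-+ [] f g = ≈-sym (+-identityˡ 0#)
  sumR-+ (x ∷ xs) f g = ≈-trans (+-congˡ (sumR-+ xs f g)) (interchange _ _ _ _)

  sumR-0 : ∀ {A : Set} (xs : List A) → sumR xs (λ _ → 0#) ≈ 0#
  sumR-0 [] = ≈-refl
  sumR-0 (x ∷ xs) = ≈-trans (+-identityˡ _) (sumR-0 xs)

  -- What the uniqueness argument retains of a tree: for each edge, the induced split and the
  -- weight. Indexing by edges allows several edges to induce the same split.
  record WeightedSplits (n : ℕ) : Set where
    field
      size   : ℕ
      side   : Fin size → Split n
      weight : Fin size → Carrier

    total-of : (Split n → ℕ) → Carrier
    total-of f = sumR (allFin size) λ e → f (side e) · weight e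

    total-cong : ∀ f g → (∀ e → f (side e) ≡ g (side e)) → total-of f ≈ total-of g
    total-cong f g f≡g = sumR-cong (allFin size) λ e → reflexive (cong (_· weight e) (f≡g e))

    total-+ : ∀ f g → total-of (λ σ → f σ ℕ.+ g σ) ≈ total-of f + total-of g
    total-+ f g = ≈-trans
      (sumR-cong (allFin size) λ e → ×-homo-+ (weight e) (f (side e)) (g (side e)))
      (sumR-+ (allFin size) _ _)

    Vanishes : (Split n → ℕ) → Set
    Vanishes f = ∀ e → f (side e) ≡ 0

    total-vanish : ∀ f → Vanishes f → total-of f ≈ 0#
    total-vanish f f≡0 = ≈-trans
      (sumR-cong (allFin size) λ e → reflexive (cong (_· weight e) (f≡0 e)))
      (sumR-0 (allFin size))

    IsLaminar : Set
    IsLaminar = ∀ e e′ → Laminar (side e) (side e′)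

    IsPseudostarSystem : ℕ → Set
    IsPseudostarSystem k = ∀ e → (k ≤ card (side e)) ⊎ (k ≤ card (not ∘ side e))

    module _ (laminar : IsLaminar) {p q r t : Fin n} where

      Vanishes? : ∀ f → Vanishes f ⊎ ∃ λ e → f (side e) ≢ 0
      Vanishes? f with Fin.all? (λ e → f (side e) ℕ.≟ 0)
      ... | yes f≡0 = inj₁ f≡0
      ... | no f≢0 = inj₂ (Fin.¬∀⟶∃¬ size _ (λ e → f (side e) ℕ.≟ 0) f≢0)

      -- If two of the functions were nonzero, two edges would display different pairings of p, q,
      -- r, t, which laminarity excludes.
      two-quartets-vanish : ∀ {f g h} → (∀ σ → f σ ≢ 0 → Quartet σ p q r t) →
        (∀ σ → g σ ≢ 0 → Quartet σ p r q t) → (∀ σ → h σ ≢ 0 → Quartet σ p t q r) →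
        (Vanishes f × Vanishes g) ⊎ (Vanishes f × Vanishes h) ⊎ (Vanishes g × Vanishes h)
      two-quartets-vanish {f} {g} {h} f⇒ g⇒ h⇒ with Vanishes? f | Vanishes? g | Vanishes? h
      ... | inj₁ vf | inj₁ vg | _ = inj₁ (vf , vg)
      ... | inj₁ vf | _ | inj₁ vh = inj₂ (inj₁ (vf , vh))
      ... | _ | inj₁ vg | inj₁ vh = inj₂ (inj₂ (vg , vh))
      ... | inj₂ (e , fe) | inj₂ (e′ , ge) | _ =
        ⊥-elim (Laminar⇒¬Quartets (laminar e e′) (f⇒ _ fe) (g⇒ _ ge))
      ... | inj₂ (e , fe) | _ | inj₂ (e′ , he) =
        ⊥-elim (Laminar⇒¬Quartets (laminar e e′) (Quartet-sym (f⇒ _ fe)) (h⇒ _ he))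
      ... | _ | inj₂ (e , ge) | inj₂ (e′ , he) =
        ⊥-elim (Laminar⇒¬Quartets (laminar e e′) (Quartet-sym (g⇒ _ ge)) (Quartet-sym (h⇒ _ he)))

  -- The difference functional `W` of two systems and its zeros.

  module Comparison {n : ℕ} (S S′ : WeightedSplits n) where
    open WeightedSplits
    open DecMembership (Fin._≟_ {n}) using (_∈?_)

    -- Abstract so that f can be inferred from W f.
    abstract
      W : (Split n → ℕ) → Carrier
      W f = total-of S f + - total-of S′ f

      W-def : ∀ f → W f ≈ total-of S f + - total-of S′ f
      W-def f = ≈-refl

      W-cong : ∀ {f g} → (∀ σ → f σ ≡ g σ) → W f ≈ W g
      W-cong {f} {g} f≡g =
        +-cong (total-cong S f g λ e → f≡g _) (-‿cong (total-cong S′ f g λ e → f≡g _))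

      W-+ : ∀ f g → W (λ σ → f σ ℕ.+ g σ) ≈ W f + W g
      W-+ f g = begin
        total-of S (λ σ → f σ ℕ.+ g σ) + - total-of S′ (λ σ → f σ ℕ.+ g σ)
          ≈⟨ +-cong (total-+ S f g) (-‿cong (total-+ S′ f g)) ⟩
        (total-of S f + total-of S g) + - (total-of S′ f + total-of S′ g)
          ≈⟨ +-congˡ (⁻¹-∙-comm _ _) ⟨
        (total-of S f + total-of S g) + (- total-of S′ f + - total-of S′ g)
          ≈⟨ interchange _ _ _ _ ⟩
        (total-of S f + - total-of S′ f) + (total-of S g + - total-of S′ g) ∎

    Null : (Split n → ℕ) → Set
    Null f = W f ≈ 0#

    vanish⇒Null : ∀ f → Vanishes S f → Vanishes S′ f → Null f
    vanish⇒Null f v v′ = begin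
      W f                                ≈⟨ W-def f ⟩
      total-of S f + - total-of S′ f     ≈⟨ +-cong (total-vanish S f v) (-‿cong (total-vanish S′ f v′)) ⟩
      0# + - 0#                          ≈⟨ -‿inverseʳ 0# ⟩
      0#                                 ∎

    Null-resp : ∀ {f g} → (∀ σ → f σ ≡ g σ) → Null f → Null g
    Null-resp f≡g = ≈-trans (≈-sym (W-cong f≡g))

    module _ {f g h : Split n → ℕ} (h≡f+g : ∀ σ → h σ ≡ f σ ℕ.+ g σ) where

      W-split : W h ≈ W f + W g
      W-split = ≈-trans (W-cong h≡f+g) (W-+ f g)

      W-splitʳ : Null g → W h ≈ W f
      W-splitʳ g0 = ≈-trans W-split (≈-trans (+-congˡ g0) (+-identityʳ _))

      W-splitˡ : Null f → W h ≈ W g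
      W-splitˡ f0 = ≈-trans W-split (≈-trans (+-congʳ f0) (+-identityˡ _))

      Null-sum : Null f → Null g → Null h
      Null-sum f0 g0 = ≈-trans (W-splitʳ g0) f0

      Null-left : Null h → Null g → Null f
      Null-left h0 g0 = ≈-trans (≈-sym (W-splitʳ g0)) h0

      Null-right : Null h → Null f → Null g
      Null-right h0 f0 = ≈-trans (≈-sym (W-splitˡ f0)) h0

    module _ (laminar : IsLaminar S) (laminar′ : IsLaminar S′) {p q r t : Fin n} {f g h : Split n → ℕ}
             (f⇒ : ∀ σ → f σ ≢ 0 → Quartet σ p q r t) (g⇒ : ∀ σ → g σ ≢ 0 → Quartet σ p r q t)
             (h⇒ : ∀ σ → h σ ≢ 0 → Quartet σ p t q r) where

      -- Each of the two trees excludes two of the three pairings, so some pairing is excluded by both.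
      one-quartet-Null : Null f ⊎ Null g ⊎ Null h
      one-quartet-Null
        with two-quartets-vanish S laminar f⇒ g⇒ h⇒ | two-quartets-vanish S′ laminar′ f⇒ g⇒ h⇒
      ... | inj₁ (v , _) | inj₁ (v′ , _) = inj₁ (vanish⇒Null f v v′)
      ... | inj₁ (v , _) | inj₂ (inj₁ (v′ , _)) = inj₁ (vanish⇒Null f v v′)
      ... | inj₁ (_ , v) | inj₂ (inj₂ (v′ , _)) = inj₂ (inj₁ (vanish⇒Null g v v′))
      ... | inj₂ (inj₁ (v , _)) | inj₁ (v′ , _) = inj₁ (vanish⇒Null f v v′)
      ... | inj₂ (inj₁ (v , _)) | inj₂ (inj₁ (v′ , _)) = inj₁ (vanish⇒Null f v v′)
      ... | inj₂ (inj₁ (_ , v)) | inj₂ (inj₂ (_ , v′)) = inj₂ (inj₂ (vanish⇒Null h v v′))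
      ... | inj₂ (inj₂ (v , _)) | inj₁ (_ , v′) = inj₂ (inj₁ (vanish⇒Null g v v′))
      ... | inj₂ (inj₂ (_ , v)) | inj₂ (inj₁ (_ , v′)) = inj₂ (inj₂ (vanish⇒Null h v v′))
      ... | inj₂ (inj₂ (v , _)) | inj₂ (inj₂ (v′ , _)) = inj₂ (inj₁ (vanish⇒Null g v v′))

    -- Vanishing of `W` on separations with at least two labels on each side.

    module Pseudostars (laminar : IsLaminar S) (laminar′ : IsLaminar S′)
      {k : ℕ} (3≤k : 3 ≤ k)
      (star : IsPseudostarSystem S k) (star′ : IsPseudostarSystem S′ k)
      (crosses-Null : ∀ K → Unique K → length K ≡ k → Null (crosses K)) where

      -- All four `crosses` terms of the four-point identity belong to k-subsets, hence are null and
      -- drop out. Here `x ∷ J` has k - 2 elements, at least one because 3 ≤ k.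
      quartet-swap : ∀ {i j l m x J} → Unique (i ∷ j ∷ l ∷ m ∷ x ∷ J) → length (i ∷ j ∷ x ∷ J) ≡ k →
        W (quartet i j l m (x ∷ J)) ≈ W (quartet i l j m (x ∷ J))
      quartet-swap {i} {j} {l} {m} {x} {J}
        ((i≢j ∷ i≢l ∷ i≢m ∷ i∉J) ∷ (j≢l ∷ j≢m ∷ j∉J) ∷ (l≢m ∷ l∉J) ∷ m∉J ∷ uJ) len = begin
        W (quartet i j l m (x ∷ J))   ≈⟨ W-splitˡ (λ _ → refl) (Null-sum (λ _ → refl) ij lm) ⟨
        W (λ σ → (crosses (i ∷ j ∷ x ∷ J) σ ℕ.+ crosses (l ∷ m ∷ x ∷ J) σ) ℕ.+ quartet i j l m (x ∷ J) σ)
                                      ≈⟨ W-cong (crosses-quartet i j l m x J) ⟩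
        W (λ σ → (crosses (i ∷ l ∷ x ∷ J) σ ℕ.+ crosses (j ∷ m ∷ x ∷ J) σ) ℕ.+ quartet i l j m (x ∷ J) σ)
                                      ≈⟨ W-splitˡ (λ _ → refl) (Null-sum (λ _ → refl) il jm) ⟩
        W (quartet i l j m (x ∷ J))   ∎
        where
        ij = crosses-Null (i ∷ j ∷ x ∷ J) ((i≢j ∷ i∉J) ∷ j∉J ∷ uJ) len
        lm = crosses-Null (l ∷ m ∷ x ∷ J) ((l≢m ∷ l∉J) ∷ m∉J ∷ uJ) len
        il = crosses-Null (i ∷ l ∷ x ∷ J) ((i≢l ∷ i∉J) ∷ l∉J ∷ uJ) len
        jm = crosses-Null (j ∷ m ∷ x ∷ J) ((j≢m ∷ j∉J) ∷ m∉J ∷ uJ) len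

      quartet-comm : ∀ (i j l m : Fin n) J σ → quartet i j l m J σ ≡ quartet i j m l J σ
      quartet-comm i j l m J σ = cong₂ ℕ._+_
        (separates-↭ʳ (i ∷ j ∷ J) (++-comm (l ∷ []) (m ∷ [])) σ) (separates-↭ʳ (i ∷ j ∷ []) (swap l m (↭-refl {x = J})) σ)

      -- The null pairing supplied by `one-quartet-Null` is ij|lm itself, or is carried to it by
      -- `quartet-swap`, in the last case after exchanging l and m.
      quartet-Null : ∀ {i j l m x J} → Unique (i ∷ j ∷ l ∷ m ∷ x ∷ J) → length (i ∷ j ∷ x ∷ J) ≡ k →
        Null (quartet i j l m (x ∷ J))
      quartet-Null {i} {j} {l} {m} {x} {J} u len =
        [ id , [ ≈-trans (quartet-swap u len)
               , ≈-trans (≈-trans (W-cong (quartet-comm i j l m (x ∷ J)))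
                           (quartet-swap (Unique-resp-↭ (prep i (prep j (swap l m ↭-refl))) u) len)) ]′ ]′
          (one-quartet-Null laminar laminar′ (quartet⇒Quartet i j l m (x ∷ J))
            (quartet⇒Quartet i l j m (x ∷ J)) (quartet⇒Quartet i m j l (x ∷ J)))

      -- The pairs of five labels form the Petersen graph; W changes sign along its edges,
      -- and vanishes because of its 5-cycles.
      module _ (J : List (Fin n)) where

        pair : (a b c d e : Fin n) → Carrier
        pair a b c d e = W (separates (a ∷ b ∷ []) (c ∷ d ∷ e ∷ J))

        -- The two values are the two summands of the quartet ab|cd: one leaves `e ∷ J` with c, d,
        -- the other with a, b.
        pair-antisym : ∀ {a b c d e} → Unique (a ∷ b ∷ c ∷ d ∷ e ∷ J) → length (a ∷ b ∷ e ∷ J) ≡ k →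
          pair a b c d e + pair c d e a b ≈ 0#
        pair-antisym {a} {b} {c} {d} {e} u len = begin
          pair a b c d e + pair c d e a b
            ≈⟨ +-congˡ (W-cong λ σ → trans (separates-↭ʳ (c ∷ d ∷ []) (↭-sym (shift e (a ∷ b ∷ []) J)) σ)
                                            (separates-sym (c ∷ d ∷ []) (a ∷ b ∷ e ∷ J) σ)) ⟩
          pair a b c d e + W (separates (a ∷ b ∷ e ∷ J) (c ∷ d ∷ []))
            ≈⟨ +-comm _ _ ⟩
          W (separates (a ∷ b ∷ e ∷ J) (c ∷ d ∷ [])) + pair a b c d e
            ≈⟨ W-+ _ _ ⟨
          W (quartet a b c d (e ∷ J))
            ≈⟨ quartet-Null u len ⟩
          0# ∎

        rotate : ∀ {a b c d e} → Unique (a ∷ b ∷ c ∷ d ∷ e ∷ J) → Unique (c ∷ d ∷ e ∷ a ∷ b ∷ J)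
        rotate {a} {b} {c} {d} {e} =
          Unique-resp-↭ (++⁺ʳ J (++-comm (a ∷ b ∷ []) (c ∷ d ∷ e ∷ [])))

        pair-Null : ∀ {a b c d e} → Unique (a ∷ b ∷ c ∷ d ∷ e ∷ J) → length (a ∷ b ∷ e ∷ J) ≡ k →
          Null (separates (a ∷ b ∷ []) (c ∷ d ∷ e ∷ J))
        pair-Null {a} {b} {c} {d} {e} u₁ len = ·-torsionfree 1 (begin
          x₁ + (x₁ + 0#) ≈⟨ +-congˡ (+-identityʳ x₁) ⟩
          x₁ + x₁        ≈⟨ +-congˡ (≈-trans (alternate (pair-antisym u₁ len) (pair-antisym u₂ len))
                                      (alternate (pair-antisym u₃ len) (pair-antisym u₄ len))) ⟩
          x₁ + x₅        ≈⟨ +-comm _ _ ⟩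
          x₅ + x₁        ≈⟨ pair-antisym u₅ len ⟩
          0#             ∎)
          where
          -- Rotation by two places runs through the 5-cycle ab, cd, ea, bc, de. Its length is odd,
          -- so the alternating signs give 2 x₁ = 0.
          u₂ = rotate u₁
          u₃ = rotate u₂
          u₄ = rotate u₃
          u₅ = rotate u₄
          x₁ = pair a b c d e
          x₅ = pair d e a b c
          alternate : ∀ {x y z} → x + y ≈ 0# → y + z ≈ 0# → x ≈ z
          alternate {x} {y} {z} x+y≈0 y+z≈0 =
            ∙-cancelʳ y x z (≈-trans x+y≈0 (≈-trans (≈-sym y+z≈0) (+-comm y z)))

      -- The three ways to split {i, j, x} into a pair and a label joining B′ = b ∷ B all have the
      -- value - H({i, j, x} | B′), where H(A | B) = W (separates A B).
      pair-separates-insert : ∀ {x b B} →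
        (∀ {i j} → Unique (i ∷ j ∷ b ∷ B) → Null (separates (i ∷ j ∷ []) (b ∷ B))) →
        ∀ {i j} → Unique (i ∷ j ∷ x ∷ b ∷ B) → Null (separates (i ∷ j ∷ []) (x ∷ b ∷ B))
      pair-separates-insert {x} {b} {B} IH {i} {j} ((i≢j ∷ i≢x ∷ i∉B) ∷ (j≢x ∷ j∉B) ∷ x∉B ∷ uB) =
        [ id , from-triple ∘ triple ]′
          -- The four labels are i, j, x and b, the last one standing for all of `b ∷ B`; the three
          -- separations display the three pairings of them.
          (one-quartet-Null laminar laminar′ (separates⇒Quartet i j x b [] B)
            (separates⇒Quartet i x j b [] B) (separates⇒Quartet i b j x B []))
        where
        ix : Null (separates (i ∷ x ∷ []) (b ∷ B))
        ix = IH ((i≢x ∷ i∉B) ∷ x∉B ∷ uB)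
        jx : Null (separates (j ∷ x ∷ []) (b ∷ B))
        jx = IH ((j≢x ∷ j∉B) ∷ x∉B ∷ uB)
        from-triple : Null (separates (b ∷ B) (i ∷ j ∷ x ∷ [])) → Null (separates (i ∷ j ∷ []) (x ∷ b ∷ B))
        from-triple null = Null-right (separates-insert x (i ∷ j ∷ []) (b ∷ B))
          (IH ((i≢j ∷ i∉B) ∷ j∉B ∷ uB))
          (Null-resp (λ σ → trans (separates-↭ʳ (b ∷ B) (++-comm (i ∷ j ∷ []) (x ∷ [])) σ)
                              (separates-sym (b ∷ B) (x ∷ i ∷ j ∷ []) σ)) null)
        triple : Null (separates (i ∷ x ∷ []) (j ∷ b ∷ B)) ⊎ Null (separates (i ∷ b ∷ B) (j ∷ x ∷ [])) →
          Null (separates (b ∷ B) (i ∷ j ∷ x ∷ []))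
        triple (inj₁ null) = Null-resp
          (λ σ → trans (separates-sym (j ∷ i ∷ x ∷ []) (b ∷ B) σ)
                   (separates-↭ʳ (b ∷ B) (++⁺ʳ (x ∷ []) (++-comm (j ∷ []) (i ∷ []))) σ))
          (Null-left (separates-insert j (i ∷ x ∷ []) (b ∷ B)) ix null)
        triple (inj₂ null) = Null-right (separates-insert i (b ∷ B) (j ∷ x ∷ []))
          (Null-resp (separates-sym (j ∷ x ∷ []) (b ∷ B)) jx) null

      -- Labels are removed from B until |B| = k, where the 5-cycle argument applies. That argument
      -- takes three labels out of B, and 3 ≤ k rules out the shorter lists.
      pair-separates-Null : ∀ B {i j} → k ≤ length B → Unique (i ∷ j ∷ B) →
        Null (separates (i ∷ j ∷ []) B)
      pair-separates-Null [] k≤ _ = contradiction (ℕ.≤-trans 3≤k k≤) λ ()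
      pair-separates-Null (x ∷ []) k≤ _ = contradiction (ℕ.≤-trans 3≤k k≤) λ { (s≤s ()) }
      pair-separates-Null (x ∷ y ∷ []) k≤ _ = contradiction (ℕ.≤-trans 3≤k k≤) λ { (s≤s (s≤s ())) }
      pair-separates-Null (x ∷ y ∷ z ∷ B) k≤ u =
        [ (λ k<B → pair-separates-insert (pair-separates-Null (y ∷ z ∷ B) (ℕ.s≤s⁻¹ k<B)) u)
        , (λ k≡B → pair-Null B u (sym k≡B)) ]′ (ℕ.m≤n⇒m<n∨m≡n k≤)

      -- Induction on A for all B at once: H(xA | B) is the difference of H(A | B) and H(A | xB),
      -- both with a shorter first list.
      large-separates-Null : ∀ A {B} → 2 ≤ length A → k ≤ length B → Unique (A ++ B) → Null (separates A B)
      large-separates-Null (x ∷ []) (s≤s ()) k≤B u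
      large-separates-Null (i ∷ j ∷ []) _ k≤B u = pair-separates-Null _ k≤B u
      large-separates-Null (x ∷ A@(_ ∷ _ ∷ _)) {B} _ k≤B u =
        Null-left (separates-insert x A B)
          (large-separates-Null A (s≤s (s≤s z≤n)) k≤B (Unique-tail u))
          (large-separates-Null A (s≤s (s≤s z≤n)) (ℕ.m≤n⇒m≤1+n k≤B)
            (Unique-resp-↭ (↭-sym (shift x A B)) u))

      -- If both lists are shorter than k, no edge of a pseudostar induces the split A | B, so the
      -- function vanishes on every edge of both systems. Otherwise one list is large.
      complete-separates-Null : ∀ A B → 2 ≤ length A → 2 ≤ length B → Unique (A ++ B) →
        (∀ j → j ∈ A ⊎ j ∈ B) → Null (separates A B)
      complete-separates-Null A B 2≤A 2≤B u covers with k ℕ.≤? length B | k ℕ.≤? length A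
      ... | yes k≤B | _ = large-separates-Null A 2≤A k≤B u
      ... | _ | yes k≤A = Null-resp (separates-sym B A)
        (large-separates-Null B 2≤B k≤A (Unique-resp-↭ (++-comm A B) u))
      ... | no k≰B | no k≰A = vanish⇒Null (separates A B) (vanishes S star) (vanishes S′ star′)
        where
        vanishes : ∀ T → IsPseudostarSystem T k → Vanishes T (separates A B)
        vanishes T pseudostar e with separates A B (side T e) ℕ.≟ 0
        ... | yes ≡0 = ≡0
        ... | no ≢0 = ⊥-elim ([ small (proj₁ bounds) , small (proj₂ bounds) ]′ (pseudostar e))
          where
          bounds = separates-card A B (side T e) covers ≢0
          small : ∀ {c} → c ≤ length A ⊎ c ≤ length B → k ≤ c → ⊥
          small (inj₁ c≤A) k≤c = k≰A (ℕ.≤-trans k≤c c≤A)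
          small (inj₂ c≤B) k≤c = k≰B (ℕ.≤-trans k≤c c≤B)

      -- `R` lists the labels still to be examined. One that lies in neither A nor B is put on
      -- either side by `separates-insert`, until A and B cover all labels.
      partial-separates-Null : ∀ R A B → 2 ≤ length A → 2 ≤ length B → Unique (A ++ B) →
        (∀ j → (j ∈ A ⊎ j ∈ B) ⊎ j ∈ R) → Null (separates A B)
      partial-separates-Null [] A B 2≤A 2≤B u covers =
        complete-separates-Null A B 2≤A 2≤B u λ j → [ id , (λ ()) ]′ (covers j)
      partial-separates-Null (x ∷ R) A B 2≤A 2≤B u covers with x ∈? (A ++ B)
      ... | yes x∈ = partial-separates-Null R A B 2≤A 2≤B u λ j → place (covers j)
        where
        place : ∀ {j} → (j ∈ A ⊎ j ∈ B) ⊎ j ∈ x ∷ R → (j ∈ A ⊎ j ∈ B) ⊎ j ∈ R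
        place (inj₁ j∈) = inj₁ j∈
        place (inj₂ (here refl)) = inj₁ (∈-++⁻ A x∈)
        place (inj₂ (there j∈R)) = inj₂ j∈R
      ... | no x∉ = Null-sum (separates-insert x A B)
        (partial-separates-Null R (x ∷ A) B (ℕ.m≤n⇒m≤1+n 2≤A) 2≤B ux (placeˡ ∘ covers))
        (partial-separates-Null R A (x ∷ B) 2≤A (ℕ.m≤n⇒m≤1+n 2≤B)
          (Unique-resp-↭ (↭-sym (shift x A B)) ux) (placeʳ ∘ covers))
        where
        ux : Unique (x ∷ A ++ B)
        ux = All.¬Any⇒All¬ _ x∉ ∷ u
        placeˡ : ∀ {j} → (j ∈ A ⊎ j ∈ B) ⊎ j ∈ x ∷ R → (j ∈ x ∷ A ⊎ j ∈ B) ⊎ j ∈ R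
        placeˡ (inj₁ j∈) = inj₁ (Sum.map₁ there j∈)
        placeˡ (inj₂ (here refl)) = inj₁ (inj₁ (here refl))
        placeˡ (inj₂ (there j∈R)) = inj₂ j∈R
        placeʳ : ∀ {j} → (j ∈ A ⊎ j ∈ B) ⊎ j ∈ x ∷ R → (j ∈ A ⊎ j ∈ x ∷ B) ⊎ j ∈ R
        placeʳ (inj₁ j∈) = inj₁ (Sum.map₂ there j∈)
        placeʳ (inj₂ (here refl)) = inj₁ (inj₂ (here refl))
        placeʳ (inj₂ (there j∈R)) = inj₂ j∈R

      separates-Null : ∀ A B → 2 ≤ length A → 2 ≤ length B → Unique (A ++ B) → Null (separates A B)
      separates-Null A B 2≤A 2≤B u =
        partial-separates-Null (allFin n) A B 2≤A 2≤B u λ j → inj₂ (∈-allFin j)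

      -- Pendant splits and the step from k-subsets to all larger sets.

      -- Adding a label y to the second list changes the value by a separation with y and z on one
      -- side; both sides then have two labels, so the change is null.
      leaf-extend : ∀ P {z E} → 2 ≤ length E → Unique (z ∷ P ++ E) →
        W (separates (z ∷ []) E) ≈ W (separates (z ∷ []) (P ++ E))
      leaf-extend [] 2≤E u = ≈-refl
      leaf-extend (y ∷ P) {z} {E} 2≤E u@((z≢y ∷ z∉) ∷ uyPE) = ≈-trans (leaf-extend P 2≤E (z∉ ∷ Unique-tail uyPE))
        (W-splitˡ (separates-insert y (z ∷ []) (P ++ E))
          (separates-Null (y ∷ z ∷ []) (P ++ E) (s≤s (s≤s z≤n))
            (ℕ.≤-trans 2≤E (ℕ.≤-trans (ℕ.m≤n+m _ (length P)) (ℕ.≤-reflexive (sym (length-++ P)))))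
            (Unique-resp-↭ (swap z y ↭-refl) u)))

      -- For t = W (crosses C), every E ⊆ C with |E| ≥ 2 has W (crosses E) = |E| t; E = C forces k t = 0.
      module _ {C : List (Fin n)} (uC : Unique C) (∣C∣ : length C ≡ suc k) where

        -- Removing z from C leaves a k-subset, whose `crosses` is null, so `W (crosses C)` is the
        -- pendant value of z. It is thus the same for all labels of C.
        leaf-value : ∀ P {z E} → 2 ≤ length E → z ∷ P ++ E ↭ C →
          W (separates (z ∷ []) E) ≈ W (crosses C)
        leaf-value P {z} {E} 2≤E r = begin
          W (separates (z ∷ []) E)        ≈⟨ leaf-extend P 2≤E u ⟩
          W (separates (z ∷ []) (P ++ E)) ≈⟨ insert (P ++ E) len (crosses-Null (P ++ E) (Unique-tail u) len) ⟨
          W (crosses (z ∷ P ++ E))        ≈⟨ W-cong (crosses-↭ r) ⟩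
          W (crosses C)                   ∎
          where
          u = Unique-resp-↭ (↭-sym r) uC
          len : length (P ++ E) ≡ k
          len = ℕ.suc-injective (trans (↭-length r) ∣C∣)
          insert : ∀ K → length K ≡ k → Null (crosses K) → W (crosses (z ∷ K)) ≈ W (separates (z ∷ []) K)
          insert [] 0≡k _ = contradiction (subst (3 ≤_) (sym 0≡k) 3≤k) λ ()
          insert (c ∷ K) _ null = W-splitˡ (crosses-insert z c K) null

        crosses-value : ∀ P E → 2 ≤ length E → P ++ E ↭ C → W (crosses E) ≈ length E · W (crosses C)
        crosses-value P (z ∷ []) (s≤s ()) r
        crosses-value [] (a ∷ b ∷ []) _ r =
          contradiction (subst (3 ≤_) (sym (ℕ.suc-injective (trans (↭-length r) ∣C∣))) 3≤k) λ { (s≤s ()) }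
        -- With a single label opposite a, `leaf-value` does not apply. A third label c turns H(a |
        -- b) into one pendant value for b and one for a; it exists because C has k + 1 elements.
        crosses-value (c ∷ P) (a ∷ b ∷ []) _ r = begin
          W (crosses (a ∷ b ∷ []))                 ≈⟨ W-cong (crosses-pair a b) ⟩
          W (separates (a ∷ []) (b ∷ []))          ≈⟨ W-split (separates-insert c (a ∷ []) (b ∷ [])) ⟩
          W (separates (c ∷ a ∷ []) (b ∷ [])) + W (separates (a ∷ []) (c ∷ b ∷ []))
            ≈⟨ +-cong (≈-trans (W-cong (separates-sym (c ∷ a ∷ []) (b ∷ [])))
                         (leaf-value P (s≤s (s≤s z≤n)) (↭-trans (↭-sym rb) r)))
                      (leaf-value P (s≤s (s≤s z≤n)) (↭-trans (↭-sym ra) r)) ⟩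
          W (crosses C) + W (crosses C)            ≈⟨ +-congˡ (+-identityʳ _) ⟨
          2 · W (crosses C)                        ∎
          where
          ra : c ∷ P ++ a ∷ b ∷ [] ↭ a ∷ P ++ c ∷ b ∷ []
          ra = ↭-trans (prep c (shift a P (b ∷ []))) (↭-trans (swap c a ↭-refl)
                 (prep a (↭-sym (shift c P (b ∷ [])))))
          rb : c ∷ P ++ a ∷ b ∷ [] ↭ b ∷ P ++ c ∷ a ∷ []
          rb = ↭-trans (prep c (↭-trans (++⁺ˡ P (swap a b ↭-refl)) (shift b P (a ∷ []))))
                 (↭-trans (swap c b ↭-refl) (prep b (↭-sym (shift c P (a ∷ [])))))
        crosses-value P (z ∷ E@(e ∷ E′@(_ ∷ _))) _ r = begin
          W (crosses (z ∷ E))                      ≈⟨ W-split (crosses-insert z e E′) ⟩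
          W (crosses E) + W (separates (z ∷ []) E)
            ≈⟨ +-cong (crosses-value (z ∷ P) E 2≤E (↭-trans (↭-sym (shift z P E)) r))
                      (leaf-value P 2≤E (↭-trans (↭-sym (shift z P E)) r)) ⟩
          length E · W (crosses C) + W (crosses C) ≈⟨ +-comm _ _ ⟩
          suc (length E) · W (crosses C)           ∎
          where
          2≤E : 2 ≤ length E
          2≤E = s≤s (s≤s z≤n)

        crosses-suc-Null : Null (crosses C)
        crosses-suc-Null = multiple≈0 k 3≤k (∙-cancelˡ t (k · t) 0# (begin
          suc k · t        ≈⟨ ×-congˡ (sym ∣C∣) ⟩
          length C · t     ≈⟨ crosses-value [] C 2≤C ↭-refl ⟨
          t                ≈⟨ +-identityʳ t ⟨
          t + 0#           ∎))
          where
          t = W (crosses C)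
          2≤C : 2 ≤ length C
          2≤C = subst (2 ≤_) (sym ∣C∣) (ℕ.m≤n⇒m≤1+n (ℕ.≤-trans (ℕ.n≤1+n 2) 3≤k))
          multiple≈0 : ∀ j {x} → 3 ≤ j → j · x ≈ 0# → x ≈ 0#
          multiple≈0 (suc j) _ = ·-torsionfree j

      -- For |C| = k this is the difference of `crosses` on k + 1 and on k labels, both null. A
      -- longer C is shortened by `leaf-extend`.
      leaf-Null : ∀ C {x} → k ≤ length C → Unique (x ∷ C) → Null (separates (x ∷ []) C)
      leaf-Null [] k≤ u = contradiction (ℕ.≤-trans 3≤k k≤) λ ()
      leaf-Null (y ∷ C) {x} k≤ u with ℕ.m≤n⇒m<n∨m≡n k≤
      ... | inj₂ k≡ = Null-right (crosses-insert x y C)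
        (crosses-suc-Null u (cong suc (sym k≡))) (crosses-Null (y ∷ C) (Unique-tail u) (sym k≡))
      ... | inj₁ (s≤s k≤C) = ≈-trans
        (≈-sym (leaf-extend (y ∷ []) (ℕ.≤-trans (ℕ.n≤1+n 2) (ℕ.≤-trans 3≤k k≤C)) u))
        (leaf-Null C k≤C (drop-second u))
        where
        drop-second : ∀ {x y} {C : List (Fin n)} → Unique (x ∷ y ∷ C) → Unique (x ∷ C)
        drop-second ((_ ∷ x∉C) ∷ _ ∷ uC) = x∉C ∷ uC

      -- For the list of all labels this gives equal total weights, since the whole label set
      -- crosses every edge of a tree with all leaves labelled.
      crosses-large-Null : ∀ C → k ≤ length C → Unique C → Null (crosses C)
      crosses-large-Null [] k≤ u = contradiction (ℕ.≤-trans 3≤k k≤) λ ()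
      crosses-large-Null (x ∷ []) k≤ u = contradiction (ℕ.≤-trans 3≤k k≤) λ { (s≤s ()) }
      crosses-large-Null (x ∷ c ∷ C) k≤ u =
        [ (λ k<C → Null-sum (crosses-insert x c C)
                     (crosses-large-Null (c ∷ C) (ℕ.s≤s⁻¹ k<C) (Unique-tail u))
                     (leaf-Null (c ∷ C) (ℕ.s≤s⁻¹ k<C) u))
        , (λ k≡C → crosses-Null (x ∷ c ∷ C) u (sym k≡C)) ]′ (ℕ.m≤n⇒m<n∨m≡n k≤)

-- Subsets meeting both sides of a split; pendant splits.

card-lookup : (I : Subset n) → card (lookup I) ≡ ∣ I ∣
card-lookup I = cong ∣_∣ (Vec.tabulate∘lookup I)

length≤card : ∀ (p : Fin n → Bool) {A} → Unique A → (∀ {j} → j ∈ A → p j ≡ true) → length A ≤ card p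
length≤card p {A} u h = subst (_≤ card p) (∣fromList∣ u)
  (lookup-mono⇒∣∣≤ (fromList A) (tabulate p) λ j e →
    trans (Vec.lookup∘tabulate p j) (h (lookup-fromList⁻ A e)))

all⁺ : ∀ {A : List (Fin n)} (p : Fin n → Bool) → (∀ {x} → x ∈ A → p x ≡ true) → all p A ≡ true
all⁺ {A = []} p h = refl
all⁺ {A = x ∷ A} p h = cong₂ _∧_ (h (here refl)) (all⁺ p (h ∘ there))

any⁺ : ∀ {A : List (Fin n)} (p : Fin n → Bool) {x} → x ∈ A → p x ≡ true → any p A ≡ true
any⁺ {A = y ∷ A} p (here refl) e = cong (_∨ any p A) e
any⁺ {A = y ∷ A} p (there x∈) e = trans (cong (p y ∨_) (any⁺ p x∈ e)) (Bool.∨-zeroʳ (p y))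

any⁻ : ∀ (A : List (Fin n)) (p : Fin n → Bool) → any p A ≡ true → ∃ λ x → p x ≡ true
any⁻ (y ∷ A) p e with p y in py
... | true  = y , py
... | false = any⁻ A p e

countB≡card : ∀ (T : Tree) {m n} (f : Fin m → Fin n) p → Tree.countB T (List.tabulate f) p ≡ card (p ∘ f)
countB≡card T {zero} f p = refl
countB≡card T {suc m} f p with p (f zero)
... | true  = cong suc (countB≡card T (f ∘ suc) p)
... | false = countB≡card T (f ∘ suc) p

-- This is `inMinSubtree` expressed through the split that the edge induces; the two agree by
-- computation.
meetsBoth : Subset n → Split n → Bool
meetsBoth {n} I σ = any (λ j → lookup I j ∧ σ j) (allFin n) ∧ any (λ j → lookup I j ∧ not (σ j)) (allFin n)

meetsBoth-true : ∀ (I : Subset n) σ {i j} → lookup I i ≡ true → lookup I j ≡ true →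
  σ i ≡ true → σ j ≡ false → meetsBoth I σ ≡ true
meetsBoth-true I σ {i} {j} Ii Ij σi σj = cong₂ _∧_
  (any⁺ (λ j → lookup I j ∧ σ j) (∈-allFin i) (cong₂ _∧_ Ii σi))
  (any⁺ (λ j → lookup I j ∧ not (σ j)) (∈-allFin j) (cong₂ _∧_ Ij (cong not σj)))

meetsBoth⁻ : ∀ (I : Subset n) σ → meetsBoth I σ ≡ true →
  (∃ λ i → lookup I i ≡ true × σ i ≡ true) × (∃ λ j → lookup I j ≡ true × σ j ≡ false)
meetsBoth⁻ {n} I σ e =
  let below , above = ∧-true e
      i , ei = any⁻ (allFin n) (λ j → lookup I j ∧ σ j) below
      j , ej = any⁻ (allFin n) (λ j → lookup I j ∧ not (σ j)) above
  in (i , ∧-true ei) , (j , proj₁ (∧-true ej) , Bool.not-injective (proj₂ (∧-true ej)))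

bool-ext : ∀ {a b} → (a ≡ true → b ≡ true) → (b ≡ true → a ≡ true) → a ≡ b
bool-ext {true}  {_}     f g = sym (f refl)
bool-ext {false} {true}  f g = g refl
bool-ext {false} {false} f g = refl

meetsBoth-fromList : ∀ (K : List (Fin n)) σ → ⟦ meetsBoth (fromList K) σ ⟧ ≡ crosses K σ
meetsBoth-fromList K σ = cong ⟦_⟧ (bool-ext to from)
  where
  to : meetsBoth (fromList K) σ ≡ true → not (all σ K) ∧ not (none σ K) ≡ true
  to e with meetsBoth⁻ (fromList K) σ e
  ... | (i , Ii , σi) , (j , Ij , σj) = cong₂ (λ a b → not a ∧ not b)
    (Bool.¬-not λ e → clash (all⁻ σ e (lookup-fromList⁻ K Ij)) σj)
    (Bool.¬-not λ e → clash (all⁻ (not ∘ σ) e (lookup-fromList⁻ K Ii)) (cong not σi))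
  witness : ∀ (p : Fin _ → Bool) A → not (all p A) ≡ true → ∃ λ j → j ∈ A × p j ≡ false
  witness p (x ∷ A) e with p x in px
  ... | false = x , here refl , px
  ... | true  = let j , j∈A , pj = witness p A e in j , there j∈A , pj
  from : not (all σ K) ∧ not (none σ K) ≡ true → meetsBoth (fromList K) σ ≡ true
  from e =
    let j , j∈K , σj = witness σ K (proj₁ (∧-true e))
        i , i∈K , σi = witness (not ∘ σ) K (proj₂ (∧-true e))
    in meetsBoth-true (fromList K) σ (lookup-fromList⁺ i∈K) (lookup-fromList⁺ j∈K)
         (Bool.not-injective σi) σj

-- A subset missing one side would be contained in the other, which is too small.
meetsBoth-large : ∀ (I : Subset n) σ → ¬ (∣ I ∣ ≤ card σ) → ¬ (∣ I ∣ ≤ card (not ∘ σ)) → meetsBoth I σ ≡ true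
meetsBoth-large {n} I σ ¬below ¬above = cong₂ _∧_ (Bool.¬-not (¬above ∘ avoids σ)) (Bool.¬-not λ e →
  ¬below (contained σ λ j Ij → Bool.not-injective (outside-of (not ∘ σ) e j Ij)))
  where
  contained : ∀ p → (∀ j → lookup I j ≡ true → p j ≡ true) → ∣ I ∣ ≤ card p
  contained p h = lookup-mono⇒∣∣≤ I (tabulate p) λ j Ij → trans (Vec.lookup∘tabulate p j) (h j Ij)
  outside-of : ∀ p → any (λ j → lookup I j ∧ p j) (allFin n) ≡ false → ∀ j → lookup I j ≡ true → p j ≡ false
  outside-of p e j Ij = Bool.¬-not λ pj →
    clash (any⁺ (λ j → lookup I j ∧ p j) (∈-allFin j) (cong₂ _∧_ Ij pj)) e
  avoids : ∀ p → any (λ j → lookup I j ∧ p j) (allFin n) ≡ false → ∣ I ∣ ≤ card (not ∘ p)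
  avoids p e = contained (not ∘ p) λ j Ij → cong not (outside-of p e j Ij)

-- The second alternative arises when the leaf is the root: the side away from the root then
-- consists of all the other labels.
Pendant : Split n → Fin n → Set
Pendant σ j = (∀ i → σ i ≡ does (i Fin.≟ j)) ⊎ (∀ i → σ i ≡ not (does (i Fin.≟ j)))

-- If j belongs to I, then |I| ≥ 2 provides a second element of I, which lies on the other side.
meetsBoth-pendant : ∀ (I : Subset n) {σ j} → 2 ≤ ∣ I ∣ → Pendant σ j → meetsBoth I σ ≡ lookup I j
meetsBoth-pendant I {σ} {j} 2≤I pendant = bool-ext (to pendant) (from pendant)
  where
  does-refl : does (j Fin.≟ j) ≡ true
  does-refl with j Fin.≟ j
  ... | yes _ = refl
  ... | no j≢j = contradiction refl j≢j
  does-true : ∀ {i} → does (i Fin.≟ j) ≡ true → i ≡ j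
  does-true {i} e with i Fin.≟ j
  ... | yes i≡j = i≡j
  to : Pendant σ j → meetsBoth I σ ≡ true → lookup I j ≡ true
  to pendant e with meetsBoth⁻ I σ e | pendant
  ... | (i , Ii , σi) , _ | inj₁ p = subst (λ i → lookup I i ≡ true) (does-true (trans (sym (p i)) σi)) Ii
  ... | _ , (i , Ii , σi) | inj₂ p =
    subst (λ i → lookup I i ≡ true) (does-true (Bool.not-injective (trans (sym (p i)) σi))) Ii
  from : Pendant σ j → lookup I j ≡ true → meetsBoth I σ ≡ true
  from pendant Ij with Fin.any? (λ i → (lookup I i Bool.≟ true) ×-dec ¬? (i Fin.≟ j))
  ... | no only-j = contradiction (ℕ.≤-trans 2≤I I≤1) λ { (s≤s ()) }
    where
    I≤1 : ∣ I ∣ ≤ 1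
    I≤1 = subst (_≤ 1) (card-lookup I) (card≤length (lookup I) (j ∷ []) λ i Ii → at-j i Ii)
      where
      at-j : ∀ i → lookup I i ≡ true → i ∈ j ∷ []
      at-j i Ii with i Fin.≟ j
      ... | yes i≡j = here i≡j
      ... | no i≢j = contradiction (i , Ii , i≢j) only-j
  ... | yes (i , Ii , i≢j) with pendant
  ...   | inj₁ p = meetsBoth-true I σ Ij Ii (trans (p j) does-refl) (trans (p i) (Bool.¬-not (i≢j ∘ does-true)))
  ...   | inj₂ p = meetsBoth-true I σ Ii Ij (trans (p i) (cong not (Bool.¬-not (i≢j ∘ does-true))))
                     (trans (p j) (cong not does-refl))

-- Ancestors, leaves and edge sides in rooted trees.

module TreeProperties (T : Tree) where
  open Tree T

  -- u lies on the path from the second vertex to the root, endpoints included. This replaces the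
  -- fuel of `belowFuel` by an inductive path.
  data Ancestor (u : Vertex) : Vertex → Set where
    self : Ancestor u u
    step : ∀ {i} → Ancestor u (parent i) → Ancestor u (suc i)

  Ancestor-trans : ∀ {u v w} → Ancestor u v → Ancestor v w → Ancestor u w
  Ancestor-trans a self = a
  Ancestor-trans a (step b) = step (Ancestor-trans a b)

  Ancestor-linear : ∀ {u v w} → Ancestor u w → Ancestor v w → Ancestor u v ⊎ Ancestor v u
  Ancestor-linear self b = inj₂ b
  Ancestor-linear a@(step _) self = inj₁ a
  Ancestor-linear (step a) (step b) = Ancestor-linear a b

  child⇒Ancestor : ∀ {i u} → parent i ≡ u → Ancestor u (suc i)
  child⇒Ancestor refl = step self

  ¬Ancestor-root : ∀ {e} → ¬ Ancestor (suc e) zero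
  ¬Ancestor-root ()

  Ancestor-rootChild : ∀ {e c} → parent c ≡ zero → Ancestor (suc e) (suc c) → e ≡ c
  Ancestor-rootChild pc self = refl
  Ancestor-rootChild pc (step a) = contradiction (subst (Ancestor _) pc a) ¬Ancestor-root

  belowFuel⇒Ancestor : ∀ f {u} v → belowFuel f u v ≡ true → Ancestor u v
  belowFuel⇒Ancestor zero {u} v e with v Fin.≟ u
  ... | yes refl = self
  belowFuel⇒Ancestor (suc f) {u} v e with v Fin.≟ u
  ... | yes refl = self
  belowFuel⇒Ancestor (suc f) zero e | no _ = belowFuel⇒Ancestor f zero e
  belowFuel⇒Ancestor (suc f) (suc i) e | no _ = step (belowFuel⇒Ancestor f (parent i) e)

  -- Each step to a parent lowers the index, so `toℕ v` steps reach every ancestor of v.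
  Ancestor⇒belowFuel : ∀ f {u v} → toℕ v ≤ f → Ancestor u v → belowFuel f u v ≡ true
  Ancestor⇒belowFuel zero {u} _ self with u Fin.≟ u
  ... | yes _ = refl
  ... | no u≢u = contradiction refl u≢u
  Ancestor⇒belowFuel (suc f) {u} _ self with u Fin.≟ u
  ... | yes _ = refl
  ... | no u≢u = contradiction refl u≢u
  Ancestor⇒belowFuel (suc f) {u} (s≤s i≤f) (step {i} a) =
    trans (cong (does (suc i Fin.≟ u) ∨_) (Ancestor⇒belowFuel f (ℕ.≤-trans (parent≤ i) i≤f) a))
      (Bool.∨-zeroʳ (does (suc i Fin.≟ u)))

  lowerSide⇒Ancestor : ∀ {e} v → lowerSide e v ≡ true → Ancestor (suc e) v
  lowerSide⇒Ancestor v = belowFuel⇒Ancestor (suc m) v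

  Ancestor⇒lowerSide : ∀ {e v} → Ancestor (suc e) v → lowerSide e v ≡ true
  Ancestor⇒lowerSide = Ancestor⇒belowFuel (suc m) (Fin.toℕ≤n _)

  ¬Ancestor⇒lowerSide : ∀ {e v} → ¬ Ancestor (suc e) v → lowerSide e v ≡ false
  ¬Ancestor⇒lowerSide ¬a = Bool.¬-not (¬a ∘ lowerSide⇒Ancestor _)

  lowerSide≡does : ∀ {e v} {P : Set} (P? : Dec P) → (P → Ancestor (suc e) v) → (Ancestor (suc e) v → P) →
    lowerSide e v ≡ does P?
  lowerSide≡does (yes p) to from = Ancestor⇒lowerSide (to p)
  lowerSide≡does (no ¬p) to from = ¬Ancestor⇒lowerSide (¬p ∘ from)

  -- Both edges lie above a, hence are comparable. One lower side then contains the other, contrary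
  -- to b or c.
  lowerSide-laminar : ∀ e f a b c → lowerSide e a ≡ true → lowerSide f a ≡ true →
    lowerSide e b ≡ true → lowerSide f b ≡ false → lowerSide e c ≡ false → lowerSide f c ≡ true → ⊥
  lowerSide-laminar e f a b c ea fa eb fb ec fc
    with Ancestor-linear (lowerSide⇒Ancestor a ea) (lowerSide⇒Ancestor a fa)
  ... | inj₁ e≤f = clash (Ancestor⇒lowerSide (Ancestor-trans e≤f (lowerSide⇒Ancestor c fc))) ec
  ... | inj₂ f≤e = clash (Ancestor⇒lowerSide (Ancestor-trans f≤e (lowerSide⇒Ancestor b eb))) fb

  isChild : Vertex → Edge → Bool
  isChild v i = does (parent i Fin.≟ v)

  isChild⇒ : ∀ {v i} → isChild v i ≡ true → parent i ≡ v
  isChild⇒ {v} {i} e with parent i Fin.≟ v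
  ... | yes p = p

  ⇒isChild : ∀ {v i} → parent i ≡ v → isChild v i ≡ true
  ⇒isChild {v} {i} p with parent i Fin.≟ v
  ... | yes _ = refl
  ... | no ¬p = contradiction p ¬p

  degree-root : degree zero ≡ card (isChild zero)
  degree-root = trans (ℕ.+-identityʳ _) (countB≡card T id (isChild zero))

  degree-nonroot : ∀ i → degree (suc i) ≡ suc (card (isChild (suc i)))
  degree-nonroot i = trans (ℕ.+-comm _ 1) (cong suc (countB≡card T id (isChild (suc i))))

  childless⇒IsLeaf : ∀ {i} → (∀ j → parent j ≢ suc i) → IsLeaf (suc i)
  childless⇒IsLeaf {i} none = trans (degree-nonroot i) (cong suc (ℕ.n≤0⇒n≡0
    (card≤length (isChild (suc i)) [] λ j e → contradiction (isChild⇒ e) (none j))))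

  IsLeaf⇒childless : ∀ {i} → IsLeaf (suc i) → ∀ j → parent j ≢ suc i
  IsLeaf⇒childless {i} leaf j p = contradiction
    (ℕ.≤-trans (length≤card (isChild (suc i)) {j ∷ []} ([] ∷ []) λ { (here refl) → ⇒isChild p })
      (ℕ.≤-reflexive (ℕ.suc-injective (trans (sym (degree-nonroot i)) leaf)))) λ ()

  onlyChild⇒IsLeaf-root : ∀ {c} → parent c ≡ zero → (∀ j → parent j ≡ zero → j ≡ c) → IsLeaf zero
  onlyChild⇒IsLeaf-root {c} pc only = trans degree-root (ℕ.≤-antisym
    (card≤length (isChild zero) (c ∷ []) λ j e → here (only j (isChild⇒ e)))
    (length≤card (isChild zero) {c ∷ []} ([] ∷ []) λ { (here refl) → ⇒isChild pc }))

  IsLeaf-root⇒onlyChild : IsLeaf zero → ∃ λ c → parent c ≡ zero × (∀ j → parent j ≡ zero → j ≡ c)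
  IsLeaf-root⇒onlyChild leaf with Fin.any? (λ j → parent j Fin.≟ zero)
  ... | no childless = contradiction
    (ℕ.≤-trans (ℕ.≤-reflexive (trans (sym leaf) degree-root))
      (card≤length (isChild zero) [] λ j e → contradiction (j , isChild⇒ e) childless)) λ ()
  ... | yes (c , pc) = c , pc , only
    where
    only : ∀ j → parent j ≡ zero → j ≡ c
    only j pj with j Fin.≟ c
    ... | yes j≡c = j≡c
    ... | no j≢c = contradiction
      (ℕ.≤-trans (length≤card (isChild zero) ((j≢c ∷ []) ∷ [] ∷ [])
          λ { (here refl) → ⇒isChild pj ; (there (here refl)) → ⇒isChild pc })
        (ℕ.≤-reflexive (trans (sym degree-root) leaf))) λ { (s≤s ()) }

  -- A child has a larger index than its parent, so descending through children must stop, and it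
  -- stops at a leaf. The fuel bounds the number of indices left.
  leaf-descendant : ∀ i → ∃ λ v → Ancestor (suc i) v × IsLeaf v
  leaf-descendant i = descend m i (ℕ.m≤m+n m (toℕ i))
    where
    descend : ∀ f i → m ≤ f ℕ.+ toℕ i → ∃ λ v → Ancestor (suc i) v × IsLeaf v
    descend zero i m≤i = contradiction (Fin.toℕ<n i) (ℕ.≤⇒≯ m≤i)
    descend (suc f) i m≤ with Fin.any? (λ j → parent j Fin.≟ suc i)
    ... | no childless = suc i , self , childless⇒IsLeaf λ j p → childless (j , p)
    ... | yes (j , p) =
      let i<j = subst (λ v → toℕ v ≤ toℕ j) p (parent≤ j)
          v , a , leaf = descend f j (ℕ.≤-trans m≤
            (subst (_≤ f ℕ.+ toℕ j) (ℕ.+-suc f (toℕ i)) (ℕ.+-monoʳ-≤ f i<j)))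
      in v , Ancestor-trans (child⇒Ancestor p) a , leaf

  rootChild-ancestor : ∀ i → ∃ λ c → parent c ≡ zero × Ancestor (suc c) (suc i)
  rootChild-ancestor i = climb (suc m) i (ℕ.m≤n⇒m≤1+n (Fin.toℕ<n i))
    where
    climb : ∀ f i → toℕ i ℕ.< f → ∃ λ c → parent c ≡ zero × Ancestor (suc c) (suc i)
    climb (suc f) i (s≤s i≤f) with parent i in pi
    ... | zero = i , pi , self
    ... | suc j =
      let c , pc , a = climb f j (ℕ.≤-trans (subst (λ v → toℕ v ≤ toℕ i) pi (parent≤ i)) i≤f)
      in c , pc , Ancestor-trans a (child⇒Ancestor pi)

  -- Let c be the child of the root above e. If c is the only child, the root is a leaf; otherwise a
  -- leaf below another child is taken.
  leaf-outside : ∀ e → ∃ λ v → lowerSide e v ≡ false × IsLeaf v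
  leaf-outside e with rootChild-ancestor e
  ... | c , pc , c≤e with Fin.any? (λ j → (parent j Fin.≟ zero) ×-dec ¬? (j Fin.≟ c))
  ...   | no none = zero , ¬Ancestor⇒lowerSide ¬Ancestor-root , onlyChild⇒IsLeaf-root pc only
    where
    only : ∀ j → parent j ≡ zero → j ≡ c
    only j pj with j Fin.≟ c
    ... | yes j≡c = j≡c
    ... | no j≢c = contradiction (j , pj , j≢c) none
  ...   | yes (j , pj , j≢c) =
    let v , j≤v , leaf = leaf-descendant j
    -- Were v below e, then e and j would be comparable; e above j forces e = j, because j hangs
    -- from the root.
    in v , ¬Ancestor⇒lowerSide (λ e≤v → [ j≰e , (λ e≤j → j≰e (subst (λ i → Ancestor (suc j) (suc i))
                                  (sym (Ancestor-rootChild pj e≤j)) self)) ]′ (Ancestor-linear j≤v e≤v)) , leaf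
    where
    j≰e : ¬ Ancestor (suc j) (suc e)
    j≰e j≤e = [ (λ j≤c → j≢c (Ancestor-rootChild pc j≤c)) , (λ c≤j → j≢c (sym (Ancestor-rootChild pj c≤j))) ]′
      (Ancestor-linear j≤e c≤e)

  Ancestor⇒≡⊎child : ∀ {u v} → Ancestor u v → v ≡ u ⊎ ∃ λ j → parent j ≡ u
  Ancestor⇒≡⊎child self = inj₁ refl
  Ancestor⇒≡⊎child (step {i} a) = inj₂ ([ (λ p → i , p) , id ]′ (Ancestor⇒≡⊎child a))

  -- A leaf other than the root has only itself below it. If the root is a leaf, all other vertices
  -- lie below its only child, so the side is a complement.
  pendantEdge : ∀ v → IsLeaf v → ∃ λ e →
    (∀ w → lowerSide e w ≡ does (w Fin.≟ v)) ⊎ (∀ w → lowerSide e w ≡ not (does (w Fin.≟ v)))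
  pendantEdge (suc i) leaf = i , inj₁ λ w → lowerSide≡does (w Fin.≟ suc i) (λ { refl → self })
    ([ id , (λ { (j , p) → contradiction p (IsLeaf⇒childless leaf j) }) ]′ ∘ Ancestor⇒≡⊎child)
  pendantEdge zero leaf =
    let c , pc , only = IsLeaf-root⇒onlyChild leaf
    in c , inj₂ λ w → lowerSide≡does (¬? (w Fin.≟ zero)) (below-child only w) λ { a refl → ¬Ancestor-root a }
    where
    below-child : ∀ {c} → (∀ j → parent j ≡ zero → j ≡ c) → ∀ w → w ≢ zero → Ancestor (suc c) w
    below-child only zero 0≢0 = contradiction refl 0≢0
    below-child only (suc i) _ =
      let c′ , pc′ , a = rootChild-ancestor i
      in subst (λ c → Ancestor (suc c) (suc i)) (only c′ pc′) a

-- Labelled trees as weighted split systems; uniqueness of the total weight.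

module Theorem (R : RealField) where
  open RealField R hiding (_≤_; ring; zero) renaming (refl to ≈-refl; sym to ≈-sym; trans to ≈-trans)
  open RealField R using () renaming (_<_ to infix 4 _<ᴿ_)
  open WithReals R
  open OrderedField R
  open Mult +-commutativeMonoid hiding (_×_)
  open AbelianGroupProperties +-abelianGroup using (x∙y⁻¹≈ε⇒x≈y; xyx⁻¹≈y; ∙-cancelˡ)
  open IsTotalOrder isTotalOrder using (≤-resp-≈)
  open CommutativeSemigroupProperties +-commutativeSemigroup using (interchange)
  open import Relation.Binary.Reasoning.Setoid setoid

  module _ {n : ℕ} (T : LTree n) where
    open LTree T
    open TreeProperties tree

    splits : WeightedSplits n
    splits = record { size = m ; side = λ e j → lowerSide e (lab j) ; weight = weight }

    open WeightedSplits splits using (side; total-of; IsLaminar; IsPseudostarSystem)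

    splits-laminar : IsLaminar
    splits-laminar e f a b c = lowerSide-laminar e f (lab a) (lab b) (lab c)

    splits-pseudostar : ∀ {k} → IsPseudostar T k → IsPseudostarSystem k
    splits-pseudostar {k} star e = Sum.map
      (subst (k ≤_) (countB≡card tree id (side e)))
      (subst (k ≤_) (countB≡card tree id (not ∘ side e))) (star e)

    if-· : ∀ b x → (if b then x else 0#) ≈ ⟦ b ⟧ · x
    if-· true  x = ≈-sym (+-identityʳ x)
    if-· false x = ≈-refl

    D-sum : ∀ I → D T I ≈ sumR (allFin m) (λ e → ⟦ inMinSubtree T I e ⟧ · weight e)
    D-sum I = sumR-cong (allFin m) λ e → if-· (inMinSubtree T I e) (weight e)

    D-fromList : ∀ K → D T (fromList K) ≈ total-of (crosses K)
    D-fromList K = ≈-trans (D-sum (fromList K)) (sumR-cong (allFin m) λ e →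
      reflexive (cong (_· weight e) (meetsBoth-fromList K (side e))))

    -- Every edge has a leaf on either side, and all leaves are labelled, so each weight is counted
    -- exactly once.
    Dtot-crosses : LeafSetIsN T → Dtot T ≈ total-of (crosses (allFin n))
    Dtot-crosses labelled = sumR-cong (allFin m) λ e →
      ≈-trans (≈-sym (+-identityʳ (weight e))) (reflexive (cong (_· weight e) (sym (crosses-all e))))
      where
      crosses-all : ∀ e → crosses (allFin n) (side e) ≡ 1
      crosses-all e =
        let v , e≤v , leaf = leaf-descendant e
            j , lab-j = labelled v leaf
            v′ , e≰v′ , leaf′ = leaf-outside e
            j′ , lab-j′ = labelled v′ leaf′
            above = λ all-below → clash (all⁻ (side e) all-below (∈-allFin j′))
                      (trans (cong (lowerSide e) lab-j′) e≰v′)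
            below = λ none-below → clash (all⁻ (not ∘ side e) none-below (∈-allFin j))
                      (cong not (trans (cong (lowerSide e) lab-j) (Ancestor⇒lowerSide e≤v)))
        in cong₂ (λ a b → ⟦ not a ∧ not b ⟧) (Bool.¬-not above) (Bool.¬-not below)

    lab-does : ∀ i j → does (lab i Fin.≟ lab j) ≡ does (i Fin.≟ j)
    lab-does i j with lab i Fin.≟ lab j | i Fin.≟ j
    ... | yes _ | yes _ = refl
    ... | no _ | no _ = refl
    ... | yes e | no i≢j = contradiction (lab-inj e) i≢j
    ... | no ¬e | yes refl = contradiction refl ¬e

    pendantEdge-label : ∀ j → ∃ λ e → Pendant (side e) j
    pendantEdge-label j =
      let e , sides = pendantEdge (lab j) (lab-leaf j)
      in e , Sum.map (λ s i → trans (s (lab i)) (lab-does i j))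
                     (λ s i → trans (s (lab i)) (cong not (lab-does i j))) sides

  Dtot-unique : ∀ {n k} → 3 ≤ k → k ≤ n → (P P′ : LTree n) → IsPseudostar P k → IsPseudostar P′ k →
    LeafSetIsN P → LeafSetIsN P′ → (∀ I → ∣ I ∣ ≡ k → D P I ≈ D P′ I) → Dtot P ≈ Dtot P′
  Dtot-unique {n} {k} 3≤k k≤n P P′ star star′ leaves leaves′ same = x∙y⁻¹≈ε⇒x≈y _ _ (begin
    Dtot P + - Dtot P′     ≈⟨ +-cong (Dtot-crosses P leaves) (-‿cong (Dtot-crosses P′ leaves′)) ⟩
    total-of (splits P) (crosses (allFin n)) + - total-of (splits P′) (crosses (allFin n))
                           ≈⟨ W-def (crosses (allFin n)) ⟨
    W (crosses (allFin n)) ≈⟨ crosses-large-Null (allFin n)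
                                (subst (k ≤_) (sym (length-tabulate id)) k≤n) (Unique.allFin⁺ n) ⟩
    0#                     ∎)
    where
    open WeightedSplits using (total-of)
    open Comparison (splits P) (splits P′)
    crosses-Null : ∀ K → Unique K → length K ≡ k → Null (crosses K)
    crosses-Null K u len = begin
      W (crosses K)                              ≈⟨ W-def (crosses K) ⟩
      total-of (splits P) (crosses K) + - total-of (splits P′) (crosses K)
        ≈⟨ +-cong (D-fromList P K) (-‿cong (D-fromList P′ K)) ⟨
      D P (fromList K) + - D P′ (fromList K)     ≈⟨ +-congʳ (same (fromList K) (trans (∣fromList∣ u) len)) ⟩
      D P′ (fromList K) + - D P′ (fromList K)    ≈⟨ -‿inverseʳ _ ⟩
      0#                                         ∎
    open Pseudostars (splits-laminar P) (splits-laminar P′) 3≤k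
      (splits-pseudostar P star) (splits-pseudostar P′ star′) crosses-Null

  -- Changing weights along the pendant edges and a bad edge.

  sumR-single : ∀ {A : Set} {m} (g : Fin m → A) (f : A → Carrier) i →
    (∀ j → j ≢ i → f (g j) ≈ 0#) → sumR (List.tabulate g) f ≈ f (g i)
  sumR-single g f zero others =
    ≈-trans (+-congˡ (zeros (g ∘ suc) λ j → others (suc j) λ ())) (+-identityʳ _)
    where
    zeros : ∀ {m} (h : Fin m → _) → (∀ j → f (h j) ≈ 0#) → sumR (List.tabulate h) f ≈ 0#
    zeros {zero} h h0 = ≈-refl
    zeros {suc m} h h0 = ≈-trans (+-cong (h0 zero) (zeros (h ∘ suc) (h0 ∘ suc))) (+-identityʳ 0#)
  sumR-single g f (suc i) others = ≈-trans
    (+-cong (others zero λ ()) (sumR-single (g ∘ suc) f i λ j j≢i → others (suc j) (j≢i ∘ Fin.suc-injective)))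
    (+-identityˡ _)

  sumR-card : ∀ {n p} (g : Fin p → Fin n) (b : Fin n → Bool) z →
    sumR (List.tabulate g) (λ j → ⟦ b j ⟧ · z) ≈ card (b ∘ g) · z
  sumR-card {p = zero} g b z = ≈-refl
  sumR-card {p = suc p} g b z with b (g zero)
  ... | true  = +-cong (+-identityʳ z) (sumR-card (g ∘ suc) b z)
  ... | false = ≈-trans (+-identityˡ _) (sumR-card (g ∘ suc) b z)

  module _ {m : ℕ} where

    bump : Fin m → Carrier → (Fin m → Carrier) → Fin m → Carrier
    bump e c w f = w f + (if does (f Fin.≟ e) then c else 0#)

    -- Common form of `D` and `Dtot`: b marks the edges crossed by I in one case and all edges in
    -- the other.
    weigh : (Fin m → Bool) → (Fin m → Carrier) → Carrier
    weigh b w = sumR (allFin m) λ e → ⟦ b e ⟧ · w e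

    weigh-bump : ∀ b e c w → weigh b (bump e c w) ≈ weigh b w + ⟦ b e ⟧ · c
    weigh-bump b e c w = begin
      weigh b (bump e c w)
        ≈⟨ sumR-cong (allFin m) (λ f → ×-distrib-+ (w f) _ ⟦ b f ⟧) ⟩
      sumR (allFin m) (λ f → ⟦ b f ⟧ · w f + ⟦ b f ⟧ · δ f)
        ≈⟨ sumR-+ (allFin m) _ _ ⟩
      weigh b w + weigh b δ
        ≈⟨ +-congˡ (sumR-single id (λ f → ⟦ b f ⟧ · δ f) e λ f f≢e →
                      ≈-trans (×-congʳ ⟦ b f ⟧ (δ-off f f≢e)) (·0 ⟦ b f ⟧)) ⟩
      weigh b w + ⟦ b e ⟧ · δ e
        ≈⟨ +-congˡ (×-congʳ ⟦ b e ⟧ δ-on) ⟩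
      weigh b w + ⟦ b e ⟧ · c ∎
      where
      δ : Fin m → Carrier
      δ f = if does (f Fin.≟ e) then c else 0#
      δ-off : ∀ f → f ≢ e → δ f ≈ 0#
      δ-off f f≢e with f Fin.≟ e
      ... | yes f≡e = contradiction f≡e f≢e
      ... | no _ = ≈-refl
      δ-on : δ e ≈ c
      δ-on with e Fin.≟ e
      ... | yes _ = ≈-refl
      ... | no e≢e = contradiction refl e≢e
      ·0 : ∀ j → j · 0# ≈ 0#
      ·0 zero = ≈-refl
      ·0 (suc j) = ≈-trans (+-identityˡ _) (·0 j)

    weigh-bumps : ∀ b {n} (e : Fin n → Fin m) z w js →
      weigh b (foldr (λ j → bump (e j) z) w js) ≈ weigh b w + sumR js (λ j → ⟦ b (e j) ⟧ · z)
    weigh-bumps b e z w [] = ≈-sym (+-identityʳ _)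
    weigh-bumps b e z w (j ∷ js) = begin
      weigh b (bump (e j) z (foldr (λ j → bump (e j) z) w js))   ≈⟨ weigh-bump b (e j) z _ ⟩
      weigh b (foldr (λ j → bump (e j) z) w js) + ⟦ b (e j) ⟧ · z ≈⟨ +-congʳ (weigh-bumps b e z w js) ⟩
      weigh b w + sumR js _ + ⟦ b (e j) ⟧ · z                   ≈⟨ +-assoc _ _ _ ⟩
      weigh b w + (sumR js _ + ⟦ b (e j) ⟧ · z)                 ≈⟨ +-congˡ (+-comm _ _) ⟩
      weigh b w + sumR (j ∷ js) _                               ∎

  reweigh : ∀ {n} (T : LTree n) → (LTree.Edge T → Carrier) → LTree n
  reweigh T w = record { wt = record { tree = tree ; weight = w } ; lab = lab ; lab-inj = lab-inj ; lab-leaf = lab-leaf }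
    where open LTree T

  -- Adding z to each pendant edge and - k z to a bad edge keeps every D_I, as a k-subset uses
  -- exactly k pendant edges, and adds (n - k) z to the total weight.
  module _ {n k : ℕ} (3≤k : 3 ≤ k) (T : LTree n) (¬star : ¬ IsPseudostar T k) where
    open LTree T

    sides : Edge → Split n
    sides = WeightedSplits.side (splits T)

    badEdge : ∃ λ e → ¬ ((k ≤ leavesBelow T e) ⊎ (k ≤ leavesAbove T e))
    badEdge = Fin.¬∀⟶∃¬ m _ (λ e → (k ℕ.≤? leavesBelow T e) ⊎-dec (k ℕ.≤? leavesAbove T e)) ¬star

    leafEdge : Fin n → Edge
    leafEdge j = proj₁ (pendantEdge-label T j)

    shifted : Carrier → Edge → Carrier
    shifted z = foldr (λ j → bump (leafEdge j) z) (bump (proj₁ badEdge) (k · (- z)) weight) (allFin n)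

    weigh-shifted : ∀ b z → b (proj₁ badEdge) ≡ true →
      weigh b (shifted z) ≈ weigh b weight + (k · (- z) + card (b ∘ leafEdge) · z)
    weigh-shifted b z b-bad = begin
      weigh b (shifted z)
        ≈⟨ weigh-bumps b leafEdge z _ (allFin n) ⟩
      weigh b (bump (proj₁ badEdge) (k · (- z)) weight) + sumR (allFin n) (λ j → ⟦ b (leafEdge j) ⟧ · z)
        ≈⟨ +-cong (weigh-bump b (proj₁ badEdge) _ weight) (sumR-card id (b ∘ leafEdge) z) ⟩
      weigh b weight + ⟦ b (proj₁ badEdge) ⟧ · (k · (- z)) + card (b ∘ leafEdge) · z
        ≈⟨ +-congʳ (+-congˡ (≈-trans (reflexive (cong (λ b → ⟦ b ⟧ · (k · (- z))) b-bad)) (+-identityʳ _))) ⟩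
      weigh b weight + k · (- z) + card (b ∘ leafEdge) · z
        ≈⟨ +-assoc _ _ _ ⟩
      weigh b weight + (k · (- z) + card (b ∘ leafEdge) · z) ∎

    ·-cancel : ∀ j z → j · (- z) + j · z ≈ 0#
    ·-cancel zero z = +-identityʳ 0#
    ·-cancel (suc j) z = begin
      (- z + j · (- z)) + (z + j · z) ≈⟨ interchange _ _ _ _ ⟩
      (- z + z) + (j · (- z) + j · z) ≈⟨ +-cong (-‿inverseˡ z) (·-cancel j z) ⟩
      0# + 0#                         ≈⟨ +-identityʳ 0# ⟩
      0#                              ∎

    D-shifted : ∀ z I → ∣ I ∣ ≡ k → D (reweigh T (shifted z)) I ≈ D T I
    D-shifted z I ∣I∣≡k = begin
      D (reweigh T (shifted z)) I                     ≈⟨ D-sum (reweigh T (shifted z)) I ⟩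
      weigh b (shifted z)                             ≈⟨ weigh-shifted b z bad-crossed ⟩
      weigh b weight + (k · (- z) + card (b ∘ leafEdge) · z)
        ≈⟨ +-congˡ (+-congˡ (×-congˡ (trans (cong ∣_∣ (Vec.tabulate-cong leaf-crossed)) (trans (card-lookup I) ∣I∣≡k)))) ⟩
      weigh b weight + (k · (- z) + k · z)            ≈⟨ +-congˡ (·-cancel k z) ⟩
      weigh b weight + 0#                             ≈⟨ +-identityʳ _ ⟩
      weigh b weight                                  ≈⟨ D-sum T I ⟨
      D T I                                           ∎
      where
      b : Edge → Bool
      b = inMinSubtree T I
      -- The crossed pendant edges correspond to the elements of I; they contribute `k · z`, which
      -- cancels the `k · (- z)` on the bad edge.
      leaf-crossed : ∀ j → b (leafEdge j) ≡ lookup I j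
      leaf-crossed j = meetsBoth-pendant I
        (subst (2 ≤_) (sym ∣I∣≡k) (ℕ.≤-trans (ℕ.n≤1+n 2) 3≤k)) (proj₂ (pendantEdge-label T j))
      bad-crossed : b (proj₁ badEdge) ≡ true
      bad-crossed = meetsBoth-large I (sides (proj₁ badEdge))
        (λ le → proj₂ badEdge (inj₁ (subst₂ _≤_ ∣I∣≡k (sym (countB≡card tree id (sides (proj₁ badEdge)))) le)))
        (λ le → proj₂ badEdge (inj₂ (subst₂ _≤_ ∣I∣≡k (sym (countB≡card tree id (not ∘ sides (proj₁ badEdge)))) le)))

    card-const : ∀ p → card {p} (λ _ → true) ≡ p
    card-const zero = refl
    card-const (suc p) = cong suc (card-const p)

    Dtot-weigh : ∀ w → Dtot (reweigh T w) ≈ weigh (λ _ → true) w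
    Dtot-weigh w = sumR-cong (allFin m) λ e → ≈-sym (+-identityʳ (w e))

    Dtot-shifted : ∀ z → Dtot (reweigh T (shifted z)) ≈ Dtot T + (k · (- z) + n · z)
    Dtot-shifted z = begin
      Dtot (reweigh T (shifted z))       ≈⟨ Dtot-weigh (shifted z) ⟩
      weigh (λ _ → true) (shifted z)     ≈⟨ weigh-shifted (λ _ → true) z refl ⟩
      weigh (λ _ → true) weight + (k · (- z) + card {n} (λ _ → true) · z)
        ≈⟨ +-cong (≈-sym (Dtot-weigh weight)) (+-congˡ (×-congˡ (card-const n))) ⟩
      Dtot T + (k · (- z) + n · z)       ∎

    -- The equation (n - k) z = target - Dtot T is solved for z. Writing n = k + 1 + d, the factor
    -- is `suc d`, by which division is possible.
    Dtot-arbitrary : suc k ≤ n → ∀ target → Σ Carrier λ z → Dtot (reweigh T (shifted z)) ≈ target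
    Dtot-arbitrary k<n target with ℕ.m≤n⇒∃[o]m+o≡n k<n
    ... | d , k+d≡n with ·-divide d (target + - Dtot T)
    ...   | z , dz≈ = z , (begin
      Dtot (reweigh T (shifted z))                      ≈⟨ Dtot-shifted z ⟩
      Dtot T + (k · (- z) + n · z)
        ≈⟨ +-congˡ (+-congˡ (×-congˡ (trans (sym k+d≡n) (sym (ℕ.+-suc k d))))) ⟩
      Dtot T + (k · (- z) + (k ℕ.+ suc d) · z)          ≈⟨ +-congˡ (+-congˡ (×-homo-+ z k (suc d))) ⟩
      Dtot T + (k · (- z) + (k · z + suc d · z))        ≈⟨ +-congˡ (+-assoc _ _ _) ⟨
      Dtot T + (k · (- z) + k · z + suc d · z)          ≈⟨ +-congˡ (+-congʳ (·-cancel k z)) ⟩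
      Dtot T + (0# + suc d · z)                         ≈⟨ +-congˡ (+-identityˡ _) ⟩
      Dtot T + suc d · z                                ≈⟨ +-congˡ dz≈ ⟩
      Dtot T + (target + - Dtot T)                      ≈⟨ +-assoc _ _ _ ⟨
      Dtot T + target + - Dtot T                        ≈⟨ xyx⁻¹≈y _ _ ⟩
      target                                            ∎)

  -- Strict inequalities and the assembly of the two assertions.

  x<x+1 : ∀ x → x <ᴿ x + 1#
  x<x+1 x = x≤x+1 x , λ e → 0≉1 (∙-cancelˡ x 0# 1# (≈-trans (+-identityʳ x) e))

  <-respˡ : ∀ {x y z} → x ≈ y → x <ᴿ z → y <ᴿ z
  <-respˡ x≈y (x≤z , x≉z) = proj₂ ≤-resp-≈ x≈y x≤z , λ y≈z → x≉z (≈-trans x≈y y≈z)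

  <-respʳ : ∀ {x y z} → x ≈ y → z <ᴿ x → z <ᴿ y
  <-respʳ x≈y (z≤x , z≉x) = proj₁ ≤-resp-≈ x≈y z≤x , λ z≈y → z≉x (≈-trans z≈y (≈-sym x≈y))

  x-1<x : ∀ x → x + - 1# <ᴿ x
  x-1<x x = <-respʳ (≈-trans (+-assoc _ _ _) (≈-trans (+-congˡ (-‿inverseˡ 1#)) (+-identityʳ x))) (x<x+1 (x + - 1#))

theorem4p2 : (R : RealField) → (n k : ℕ) → 3 ≤ k → suc k ≤ n →
    (Dfam : Subset n → RealField.Carrier R) →
    WithReals.LTreelike R n k Dfam →
    ((∀ T → WithReals.InU R n k Dfam T → WithReals.IsPseudostar R T k) →
    ∀ P P' → WithReals.InU R n k Dfam P → WithReals.InU R n k Dfam P' →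
    RealField._≈_ R (WithReals.Dtot R P) (WithReals.Dtot R P'))
    ×
    (Σ (WithReals.LTree R n) (λ T → WithReals.InU R n k Dfam T × ¬ WithReals.IsPseudostar R T k) →
    (∀ b → Σ (WithReals.LTree R n) (λ T → WithReals.InU R n k Dfam T × RealField._<_ R (WithReals.Dtot R T) b))
    × (∀ b → Σ (WithReals.LTree R n) (λ T → WithReals.InU R n k Dfam T × RealField._<_ R b (WithReals.Dtot R T))))
theorem4p2 R n k 3≤k k<n Dfam _ = unique , unbounded
  where
  open RealField R using (Carrier; _≈_; _<_; _+_; -_; 1#) renaming (sym to ≈-sym; trans to ≈-trans)
  open WithReals R
  open Theorem R
  unique : (∀ T → InU n k Dfam T → IsPseudostar T k) →
    ∀ P P′ → InU n k Dfam P → InU n k Dfam P′ → Dtot P ≈ Dtot P′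
  unique star P P′ P∈U@(leaves , D≈) P′∈U@(leaves′ , D′≈) =
    Dtot-unique 3≤k (ℕ.<⇒≤ k<n) P P′ (star P P∈U) (star P′ P′∈U) leaves leaves′
      λ I ∣I∣≡k → ≈-trans (D≈ I ∣I∣≡k) (≈-sym (D′≈ I ∣I∣≡k))
  unbounded : Σ (LTree n) (λ T → InU n k Dfam T × ¬ IsPseudostar T k) →
    (∀ b → Σ (LTree n) λ T → InU n k Dfam T × (Dtot T < b)) ×
    (∀ b → Σ (LTree n) λ T → InU n k Dfam T × (b < Dtot T))
  unbounded (T , (leaves , D≈) , ¬star) =
    (λ b → let T′ , T′∈U , e = realise (b + - 1#) in T′ , T′∈U , <-respˡ (≈-sym e) (x-1<x b)) ,
    (λ b → let T′ , T′∈U , e = realise (b + 1#) in T′ , T′∈U , <-respʳ (≈-sym e) (x<x+1 b))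
    where
    -- Every real number is the total weight of some element of U; b - 1 and b + 1 then give values
    -- below and above b.
    realise : ∀ target → Σ (LTree n) λ T′ → InU n k Dfam T′ × (Dtot T′ ≈ target)
    realise target =
      let z , e = Dtot-arbitrary 3≤k T ¬star k<n target
      in reweigh T (shifted 3≤k T ¬star z) ,
         (leaves , λ I ∣I∣≡k → ≈-trans (D-shifted 3≤k T ¬star z I ∣I∣≡k) (D≈ I ∣I∣≡k)) , e
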